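{- Let $D=([n],A)$ be a peo-consistent digraph and let $\equiv$ be a lattice congruence of the acyclic reorientation lattice $\mathrm{AR}_D$. Let $R_D\subseteq \mathrm{AR}_D$ be a set of reorientations obtained by the recursive construction in the context, and let $\Pi_D=\{\pi_E\mid E\in R_D\}\subseteq S_n$. Then Algorithm J with input $\Pi_D$ and initial permutation $\mathrm{id}_n$ generates a sequence $\pi_{E_1},\pi_{E_2},\ldots$ of permutations from $\Pi_D$, where $E_1,E_2,\ldots\in \mathrm{AR}_D$ are such that $[E_1]_\equiv,[E_2]_\equiv,\ldots$ is a Hamilton path in the cover graph of the lattice quotient $\mathrm{AR}_D/{\equiv}$.
   Context: Digraphs are finite, without loops, parallel or antiparallel arcs. A vertex is a source (sink) if it has in-degree (out-degree) zero; a vertex is simplicial in an undirected graph if its neighborhood is a clique. A digraph $D$ is peo-consistent if its vertices can be labeled $1,\ldots,n$ such that either $n=1$, or (i) $n$ is a source or a sink of $D$, (ii) $n$ is simplicial in the underlying undirected graph, and (iii) $D-n$ (with the labels $1,\ldots,n-1$) is peo-consistent. We write $D=([n],A)$ for $D$ with such a labeling, and $D_i$ for the subdigraph induced by $[i]$. Acyclic reorientations. $\mathrm{AR}_D$ is the set of all acyclic digraphs obtained from $D$ by reversing some set of arcs, partially ordered by containment of the sets of arcs reversed with respect to $D$. For peo-consistent $D$ it is a lattice. A lattice congruence $\equiv$ is an equivalence relation such that $x\equiv x'$, $y\equiv y'$ imply $x\vee y\equiv x'\vee y'$ and $x\wedge y\equiv x'\wedge y'$. $[x]_\equiv$ is the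 class of $x$. The lattice quotient $L/{\equiv}$ is the poset on classes with $X<Y$ iff $X\neq Y$ and $x<y$ for some $x\in X,y\in Y$. The cover graph of a poset joins two elements iff one covers the other. Restriction and rails. For $E\in\mathrm{AR}_{D_{n-1}}$, $c(E)\in\mathrm{AR}_D$ is obtained by adding $n$ to $E$ as a source or sink as it appears in $D$ (i.e. no arc at $n$ is reversed), and $\bar c(E)\in\mathrm{AR}_D$ is obtained by adding $n$ with all its arcs reversed with respect to $D$. The restriction $\equiv^*$ is the congruence of $\mathrm{AR}_{D_{n-1}}$ with $E\equiv^*F\Leftrightarrow c(E)\equiv c(F)$. The rail $r(E)$ is the set of all reorientations in $\mathrm{AR}_D$ whose restriction to $D_{n-1}$ is $E$; it is a chain with minimum $c(E)$ and maximum $\bar c(E)$. Construction of $R_D$ (depending on $\equiv$). If $D$ is the empty digraph ($n=0$), $R_D$ consists of the unique (empty) reorientation. Otherwise let $R_{D_{n-1}}\subseteq\mathrm{AR}_{D_{n-1}}$ be the set constructed for $D_{n-1}$ and $\equiv^*$. It is known that exactly one of two cases occurs. Case 1: for every $E\in\mathrm{AR}_{D_{n-1}}$, $c(E)\not\equiv\bar c(E)$. Then for each $E\in R_{D_{n-1}}$ let $R_{r(E)}$ contain exactly one element from $X\cap r(E)$ for each class $X$ of $\equiv$ with $X\cap r(E)\neq\emptyset$, chosen such that $c(E),\bar c(E)\in R_{r(E)}$ (other choices arbitrary), and set $R_D:=\bigcup_{E\in R_{D_{n-1}}}R_{r(E)}$. Case 2: for every $E\in\mathrm{AR}_{D_{n-1}}$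 all elements of $r(E)$ are congruent. Then $R_D:=\{c(E)\mid E\in R_{D_{n-1}}\}$ if $n$ is a sink in $D$, and $R_D:=\{\bar c(E)\mid E\in R_{D_{n-1}}\}$ if $n$ is a source in $D$ (so $n$ is always added as a sink). Encoding by permutations. $S_n$ is the set of permutations of $[n]$ written as words, $\mathrm{id}_n=12\cdots n$, $\varepsilon$ is the empty permutation; for $\pi\in S_{n-1}$, $c_i(\pi)\in S_n$ is obtained by inserting the value $n$ at position $i$. For an acyclic reorientation $E$ of $D$ with restriction $E_{n-1}$ to $[n-1]$, define $\pi_E:=\varepsilon$ if $n=0$ and otherwise: (i) if $n$ is a sink in $E$, $\pi_E:=c_n(\pi_{E_{n-1}})$; (ii) else if $n$ is a source in $E$, $\pi_E:=c_1(\pi_{E_{n-1}})$; (iii) otherwise $\pi_E:=c_i(\pi_{E_{n-1}})$, where $i$ is the position in $\pi_{E_{n-1}}$ of the unique out-neighbor of $n$ in the transitive reduction of $E$ (the digraph of arcs $u\to v$ of $E$ for which $E$ has no other directed path from $u$ to $v$). The map $E\mapsto\pi_E$ is injective. Jumps. Given $\pi=a_1\cdots a_n$ with a substring $a_i\cdots a_{i+d}$, $d>0$, $a_i>a_{i+1},\ldots,a_{i+d}$, a right jump of the value $a_i$ by $d$ steps replaces this substring by $a_{i+1}\cdots a_{i+d}a_i$. Given a substring $a_{i-d}\cdots a_i$, $d>0$, $a_i>a_{i-d},\ldots,a_{i-1}$, a left jump of $a_i$ by $d$ steps replaces it by $a_ia_{i-d}\cdots a_{i-1}$. A jump is minimal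 with respect to $L_n\subseteq S_n$ if every jump of the same value in the same direction by fewer steps creates a permutation not in $L_n$. Algorithm J (input $L_n\subseteq S_n$, initial permutation $\pi_0\in L_n$). J1: Visit $\pi_0$. J2: Generate an unvisited permutation from $L_n$ by performing a minimal jump of the largest possible value in the most recently visited permutation. If no such jump exists, or the jump direction is ambiguous, terminate. Otherwise visit this permutation and repeat J2. -}

module Defs where

open import Data.Bool.Base using (Bool; true; false)
open import Data.Empty using (⊥)
open import Data.Fin.Base using (Fin; zero; suc; toℕ)
open import Data.List.Base using (List; []; _∷_; [_]; _++_; length; applyUpTo)
open import Data.List.Membership.Propositional using (_∉_)
open import Data.List.Relation.Binary.Permutation.Propositional using (_↭_)
open import Data.List.Relation.Unary.All using (All)
open import Data.List.Relation.Unary.AllPairs using (AllPairs)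
open import Data.List.Relation.Unary.Any using (Any)
open import Data.List.Relation.Unary.Linked using (Linked)
open import Data.Nat.Base using (ℕ; zero; suc; _∸_; _≤_; _<_)
open import Data.Product.Base using (∃; ∃₂; _×_; _,_)
open import Data.Product using (∃!)
open import Data.Sum.Base using (_⊎_; inj₁; inj₂)
open import Data.Unit.Base using (⊤)
open import Data.Vec.Base as Vec using (Vec; lookup)
open import Data.Vec.Properties using (lookup-map)
open import Function.Base using (_on_)
open import Function.Bundles using (_⇔_; mk⇔)
open import Level using (0ℓ)
open import Relation.Binary.Construct.Closure.Transitive using (TransClosure; _∷_) renaming ([_] to [_]⁺)
open import Relation.Binary.Core using (Rel; _⇒_)
open import Relation.Binary.Structures using (IsEquivalence)
open import Relation.Binary.PropositionalEquality.Core using (_≡_; _≢_; refl; sym; trans; cong)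
open import Relation.Nullary.Negation.Core using (¬_; contradiction)
open import Relation.Unary using (Pred; _∈_; _⊆_; _≐_; U)

-- How the newest vertex is joined to an older one: not at all, by an arc
-- leaving the newest vertex, or by an arc entering it.

data Link : Set where
  none out inn : Link

reverse : Link → Link
reverse none = none
reverse out  = inn
reverse inn  = out

-- D ▹ ls adds the vertex n + 1 to a digraph D on [n]. Having one link
-- per pair of distinct vertices rules out loops, parallel arcs and
-- antiparallel arcs, so each digraph on [n] is represented exactly once.

infixl 5 _▹_

data Digraph : ℕ → Set where
  ∅   : Digraph 0
  _▹_ : ∀ {n} → Digraph n → Vec Link n → Digraph (suc n)

-- Vertices are numbered from the newest one: in a digraph on [n], zero is
-- the vertex n, and suc embeds [n - 1] into [n]. The label of a vertex is
-- unchanged by this embedding, definitionally.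

label : ∀ {n} → Fin n → ℕ
label {n} v = n ∸ toℕ v

Arc : ∀ {n} → Digraph n → Rel (Fin n) 0ℓ
Arc (D ▹ ls) zero    zero    = ⊥
Arc (D ▹ ls) zero    (suc v) = lookup ls v ≡ out
Arc (D ▹ ls) (suc u) zero    = lookup ls u ≡ inn
Arc (D ▹ ls) (suc u) (suc v) = Arc D u v

restrict : ∀ {n} → Digraph (suc n) → Digraph n
restrict (D ▹ _) = D

Adjacent : ∀ {n} → Digraph n → Rel (Fin n) 0ℓ
Adjacent D u v = Arc D u v ⊎ Arc D v u

Source Sink Simplicial : ∀ {n} → Digraph n → Pred (Fin n) 0ℓ
Source D v = ∀ u → ¬ Arc D u v
Sink   D v = ∀ u → ¬ Arc D v u
Simplicial D v =
  ∀ u w → Adjacent D v u → Adjacent D v w → u ≢ w → Adjacent D u w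

-- The given labelling witnesses peo-consistency. The recursion ends at
-- n = 0; for n = 1 all the conditions hold trivially.

PeoConsistent : ∀ {n} → Digraph n → Set
PeoConsistent ∅          = ⊤
PeoConsistent G@(D ▹ ls) =
  (Source G zero ⊎ Sink G zero) × Simplicial G zero × PeoConsistent D

Path : ∀ {n} → Digraph n → Rel (Fin n) 0ℓ
Path D = TransClosure (Arc D)

Acyclic : ∀ {n} → Digraph n → Set
Acyclic D = ∀ v → ¬ Path D v v

-- As there are no parallel arcs, a directed path from u to v other than
-- the arc u → v has an inner vertex.

TransitiveReduction : ∀ {n} → Digraph n → Rel (Fin n) 0ℓ
TransitiveReduction D u v =
  Arc D u v × ¬ (∃ λ w → Arc D u w × Path D w v)

-- Only the arcs of D in S matter.

IsReversal : ∀ {n} → Digraph n → (Fin n → Fin n → Bool) → Digraph n → Set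
IsReversal D S E = ∀ u v →
  Arc E u v ⇔ ((Arc D u v × S u v ≡ false) ⊎ (Arc D v u × S v u ≡ true))

IsReorientation : ∀ {n} → Digraph n → Digraph n → Set
IsReorientation D E = ∃ λ S → IsReversal D S E

-- The proofs are irrelevant, so that _≡_ on AR D is equality of digraphs.

record AR {n} (D : Digraph n) : Set where
  constructor mkAR
  field
    graph            : Digraph n
    .isReorientation : IsReorientation D graph
    .isAcyclic       : Acyclic graph

open AR public using (graph)

module _ {n} {D : Digraph n} where

  Reversed : AR D → Rel (Fin n) 0ℓ
  Reversed E u v = Arc D u v × Arc (graph E) v u

  infix 4 _⊑_ _⊏_

  _⊑_ _⊏_ : Rel (AR D) 0ℓ
  E ⊑ F = Reversed E ⇒ Reversed F
  E ⊏ F = E ⊑ F × E ≢ F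

  IsJoin IsMeet : AR D → AR D → AR D → Set
  IsJoin x y z = x ⊑ z × y ⊑ z × (∀ w → x ⊑ w → y ⊑ w → z ⊑ w)
  IsMeet x y z = z ⊑ x × z ⊑ y × (∀ w → w ⊑ x → w ⊑ y → w ⊑ z)

  -- Joins and meets enter as relations: AR D is a lattice only for
  -- particular D, such as the peo-consistent ones.

  record IsLatticeCongruence (_≈_ : Rel (AR D) 0ℓ) : Set where
    field
      isEquivalence : IsEquivalence _≈_
      ∨-cong : ∀ {x x′ y y′ j j′} → x ≈ x′ → y ≈ y′ →
               IsJoin x y j → IsJoin x′ y′ j′ → j ≈ j′
      ∧-cong : ∀ {x x′ y y′ m m′} → x ≈ x′ → y ≈ y′ →
               IsMeet x y m → IsMeet x′ y′ m′ → m ≈ m′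

  -- The quotient by _≈_, with a class given by any of its members.

  module Quotient (_≈_ : Rel (AR D) 0ℓ) where

    _<[]_ _⋖[]_ CoverGraph : Rel (AR D) 0ℓ
    x <[] y = ¬ x ≈ y × ∃₂ λ x′ y′ → x ≈ x′ × y ≈ y′ × x′ ⊏ y′
    x ⋖[] y = x <[] y × ¬ (∃ λ z → x <[] z × z <[] y)
    CoverGraph x y = x ⋖[] y ⊎ y ⋖[] x

    record IsHamiltonPath (Es : List (AR D)) : Set where
      field
        consecutive : Linked CoverGraph Es
        distinct    : AllPairs (λ x y → ¬ x ≈ y) Es
        covering    : ∀ x → Any (x ≈_) Es

open Quotient public using (IsHamiltonPath)

private
  source-end : ∀ {n} (G : Digraph n) {u v} → Source G v → ¬ Path G u v
  source-end G src [ a ]⁺   = src _ a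
  source-end G src (_ ∷ as) = source-end G src as

  sink-start : ∀ {n} (G : Digraph n) {u v} → Sink G u → ¬ Path G u v
  sink-start G snk [ a ]⁺  = snk _ a
  sink-start G snk (a ∷ _) = snk _ a

  avoid-path : ∀ {n} (E : Digraph n) ls →
               Source (E ▹ ls) zero ⊎ Sink (E ▹ ls) zero →
               ∀ {u v} → Path (E ▹ ls) (suc u) (suc v) → Path E u v
  avoid-path E ls p [ a ]⁺ = [ a ]⁺
  avoid-path E ls p (_∷_ {y = suc w} a as) = a ∷ avoid-path E ls p as
  avoid-path E ls (inj₁ src) {u} (_∷_ {y = zero} a as) = contradiction a (src (suc u))
  avoid-path E ls (inj₂ snk) (_∷_ {y = zero} a as) =
    contradiction as (sink-start (E ▹ ls) snk)

  ▹-acyclic : ∀ {n} (E : Digraph n) ls →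
              Source (E ▹ ls) zero ⊎ Sink (E ▹ ls) zero →
              Acyclic E → Acyclic (E ▹ ls)
  ▹-acyclic E ls p          acy (suc v) as = acy v (avoid-path E ls p as)
  ▹-acyclic E ls (inj₁ src) acy zero    as = source-end (E ▹ ls) src as
  ▹-acyclic E ls (inj₂ snk) acy zero    as = sink-start (E ▹ ls) snk as

  reverse-involutive : ∀ l → reverse (reverse l) ≡ l
  reverse-involutive none = refl
  reverse-involutive out  = refl
  reverse-involutive inn  = refl

  lookup-reverse : ∀ {n} (ls : Vec Link n) v {l} →
                   lookup (Vec.map reverse ls) v ≡ l → lookup ls v ≡ reverse l
  lookup-reverse ls v eq =
    trans (sym (reverse-involutive (lookup ls v)))
          (cong reverse (trans (sym (lookup-map v reverse ls)) eq))

  lookup-reverse⁻ : ∀ {n} (ls : Vec Link n) v {l} →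
                    lookup ls v ≡ l → lookup (Vec.map reverse ls) v ≡ reverse l
  lookup-reverse⁻ ls v eq = trans (lookup-map v reverse ls) (cong reverse eq)

  extend : ∀ {n} → Bool → (Fin n → Fin n → Bool) →
           Fin (suc n) → Fin (suc n) → Bool
  extend b S (suc u) (suc v) = S u v
  extend b S _       _       = b

  keep : ∀ {n} {D E : Digraph n} ls →
         IsReorientation D E → IsReorientation (D ▹ ls) (E ▹ ls)
  keep ls (S , r) = extend false S , λ where
    zero    zero    → mk⇔ (λ ()) λ { (inj₁ (() , _)) ; (inj₂ (() , _)) }
    zero    (suc v) → mk⇔ (λ a → inj₁ (a , refl))
                          λ { (inj₁ (a , _)) → a ; (inj₂ (_ , ())) }
    (suc u) zero    → mk⇔ (λ a → inj₁ (a , refl))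
                          λ { (inj₁ (a , _)) → a ; (inj₂ (_ , ())) }
    (suc u) (suc v) → r u v

  flip-links : ∀ {n} {D E : Digraph n} ls → IsReorientation D E →
               IsReorientation (D ▹ ls) (E ▹ Vec.map reverse ls)
  flip-links ls (S , r) = extend true S , λ where
    zero    zero    → mk⇔ (λ ()) λ { (inj₁ (() , _)) ; (inj₂ (() , _)) }
    zero    (suc v) → mk⇔ (λ a → inj₂ (lookup-reverse ls v a , refl))
                          λ { (inj₁ (_ , ())) ; (inj₂ (a , _)) → lookup-reverse⁻ ls v a }
    (suc u) zero    → mk⇔ (λ a → inj₂ (lookup-reverse ls u a , refl))
                          λ { (inj₁ (_ , ())) ; (inj₂ (a , _)) → lookup-reverse⁻ ls u a }
    (suc u) (suc v) → r u v

  source-or-sink-keep : ∀ {n} (D E : Digraph n) ls →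
    Source (D ▹ ls) zero ⊎ Sink (D ▹ ls) zero →
    Source (E ▹ ls) zero ⊎ Sink (E ▹ ls) zero
  source-or-sink-keep D E ls (inj₁ src) =
    inj₁ λ { zero () ; (suc u) → src (suc u) }
  source-or-sink-keep D E ls (inj₂ snk) =
    inj₂ λ { zero () ; (suc u) → snk (suc u) }

  source-or-sink-flip : ∀ {n} (D E : Digraph n) ls →
    Source (D ▹ ls) zero ⊎ Sink (D ▹ ls) zero →
    let G = E ▹ Vec.map reverse ls in Source G zero ⊎ Sink G zero
  source-or-sink-flip D E ls (inj₁ src) =
    inj₂ λ { zero () ; (suc u) a → src (suc u) (lookup-reverse ls u a) }
  source-or-sink-flip D E ls (inj₂ snk) =
    inj₁ λ { zero () ; (suc u) a → snk (suc u) (lookup-reverse ls u a) }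

module _ {n} {D : Digraph n} {ls : Vec Link n}
         (p : Source (D ▹ ls) zero ⊎ Sink (D ▹ ls) zero) where

  c c̄ : AR D → AR (D ▹ ls)
  c (mkAR E reo acy) =
    mkAR (E ▹ ls) (keep ls reo)
         (▹-acyclic E ls (source-or-sink-keep D E ls p) acy)
  c̄ (mkAR E reo acy) =
    mkAR (E ▹ Vec.map reverse ls) (flip-links ls reo)
         (▹-acyclic E _ (source-or-sink-flip D E ls p) acy)

  Restriction : Rel (AR (D ▹ ls)) 0ℓ → Rel (AR D) 0ℓ
  Restriction _≈_ = _≈_ on c

Rail : ∀ {n} {D : Digraph n} {ls : Vec Link n} → AR D → Pred (AR (D ▹ ls)) 0ℓ
Rail E F = restrict (graph F) ≡ graph E

-- P can serve as R_{r(E)}. A class meeting the rail is given by one of its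
-- members F on the rail.

record IsRailChoice {n} {D : Digraph n} {ls : Vec Link n}
                    (p : Source (D ▹ ls) zero ⊎ Sink (D ▹ ls) zero)
                    (_≈_ : Rel (AR (D ▹ ls)) 0ℓ)
                    (E : AR D) (P : Pred (AR (D ▹ ls)) 0ℓ) : Set where
  field
    on-rail     : P ⊆ Rail E
    exactly-one : ∀ F → F ∈ Rail E → ∃! _≡_ λ G → G ∈ P × G ≈ F
    contains-c  : c p E ∈ P
    contains-c̄  : c̄ p E ∈ P

-- R can arise as R_D, for some choices of the sets R_{r(E)}.

data IsR : ∀ {n} (D : Digraph n) → PeoConsistent D →
           Rel (AR D) 0ℓ → Pred (AR D) 0ℓ → Set₁ where

  empty : ∀ {peo _≈_ R} → R ≐ U → IsR ∅ peo _≈_ R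

  case₁ : ∀ {n} {D : Digraph n} {ls p simp peo _≈_ R} {R′ : Pred (AR D) 0ℓ} →
          IsR D peo (Restriction p _≈_) R′ →
          (∀ E → ¬ c p E ≈ c̄ p E) →
          (choice : AR D → Pred (AR (D ▹ ls)) 0ℓ) →
          (∀ E → E ∈ R′ → IsRailChoice p _≈_ E (choice E)) →
          R ≐ (λ F → ∃ λ E → E ∈ R′ × F ∈ choice E) →
          IsR (D ▹ ls) (p , simp , peo) _≈_ R

  case₂-sink : ∀ {n} {D : Digraph n} {ls p simp peo _≈_ R} {R′ : Pred (AR D) 0ℓ} →
          IsR D peo (Restriction p _≈_) R′ →
          (∀ E F G → F ∈ Rail E → G ∈ Rail E → F ≈ G) →
          Sink (D ▹ ls) zero →
          R ≐ (λ F → ∃ λ E → E ∈ R′ × F ≡ c p E) →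
          IsR (D ▹ ls) (p , simp , peo) _≈_ R

  case₂-source : ∀ {n} {D : Digraph n} {ls p simp peo _≈_ R} {R′ : Pred (AR D) 0ℓ} →
          IsR D peo (Restriction p _≈_) R′ →
          (∀ E F G → F ∈ Rail E → G ∈ Rail E → F ≈ G) →
          Source (D ▹ ls) zero →
          R ≐ (λ F → ∃ λ E → E ∈ R′ × F ≡ c̄ p E) →
          IsR (D ▹ ls) (p , simp , peo) _≈_ R

Word : Set
Word = List ℕ

idₙ : ℕ → Word
idₙ n = applyUpTo suc n

S : ℕ → Pred Word 0ℓ
S n π = π ↭ idₙ n

-- The graph of the map E ↦ π_E. In the last case suc n is inserted at the
-- position of label v, hence directly in front of it.

data Encodes : ∀ {n} → Digraph n → Word → Set where

  empty   : Encodes ∅ []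

  sink    : ∀ {n} {E : Digraph n} {ls π} →
            Sink (E ▹ ls) zero →
            Encodes E π → Encodes (E ▹ ls) (π ++ [ suc n ])

  source  : ∀ {n} {E : Digraph n} {ls π} →
            ¬ Sink (E ▹ ls) zero → Source (E ▹ ls) zero →
            Encodes E π → Encodes (E ▹ ls) (suc n ∷ π)

  between : ∀ {n} {E : Digraph n} {ls} xs (v : Fin n) ys →
            ¬ Sink (E ▹ ls) zero → ¬ Source (E ▹ ls) zero →
            TransitiveReduction (E ▹ ls) zero (suc v) →
            (∀ w → TransitiveReduction (E ▹ ls) zero w → w ≡ suc v) →
            Encodes E (xs ++ label v ∷ ys) →
            Encodes (E ▹ ls) (xs ++ suc n ∷ label v ∷ ys)

Π : ∀ {n} {D : Digraph n} → Pred (AR D) 0ℓ → Pred Word 0ℓ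
Π R π = ∃ λ E → E ∈ R × Encodes (graph E) π

data Direction : Set where
  left right : Direction

opposite : Direction → Direction
opposite left  = right
opposite right = left

-- Jump δ a d π ρ: a jump of the value a by d steps in direction δ turns π
-- into ρ.

data Jump : Direction → ℕ → ℕ → Word → Word → Set where

  right : ∀ {a d π ρ} xs ys zs → length ys ≡ d → 0 < d → All (_< a) ys →
          π ≡ xs ++ a ∷ ys ++ zs → ρ ≡ xs ++ ys ++ a ∷ zs →
          Jump right a d π ρ

  left  : ∀ {a d π ρ} xs ys zs → length ys ≡ d → 0 < d → All (_< a) ys →
          π ≡ xs ++ ys ++ a ∷ zs → ρ ≡ xs ++ a ∷ ys ++ zs →
          Jump left a d π ρ

module _ (L : Pred Word 0ℓ) where

  MinimalJump : Direction → ℕ → Word → Word → Set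
  MinimalJump δ a π ρ = ∃ λ d → Jump δ a d π ρ ×
    (∀ d′ ρ′ → d′ < d → Jump δ a d′ π ρ′ → ¬ ρ′ ∈ L)

  -- The list holds the permutations visited so far, including the current one.

  Candidate : List Word → Direction → ℕ → Word → Word → Set
  Candidate visited δ a π ρ = MinimalJump δ a π ρ × ρ ∈ L × ρ ∉ visited

  IsLargest : List Word → ℕ → Word → Set
  IsLargest visited a π =
    (∃₂ λ δ ρ → Candidate visited δ a π ρ) ×
    (∀ b δ ρ → Candidate visited δ b π ρ → b ≤ a)

  NoJump Ambiguous : List Word → Word → Set
  NoJump visited π = ∀ δ a ρ → ¬ Candidate visited δ a π ρ
  Ambiguous visited π = ∃ λ a → IsLargest visited a π ×
    (∀ δ → ∃ λ ρ → Candidate visited δ a π ρ)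

  Step : List Word → Word → Word → Set
  Step visited π ρ = ∃₂ λ δ a → IsLargest visited a π ×
    Candidate visited δ a π ρ ×
    (∀ ρ′ → ¬ Candidate visited (opposite δ) a π ρ′)

  -- Run visited π πs: having last visited π, the algorithm goes on to
  -- visit exactly the permutations πs, in this order, and terminates.

  data Run (visited : List Word) (π : Word) : List Word → Set where
    halt : NoJump visited π ⊎ Ambiguous visited π → Run visited π []
    step : ∀ {ρ πs} → Step visited π ρ → Run (ρ ∷ visited) ρ πs →
           Run visited π (ρ ∷ πs)

record AlgorithmJ (n : ℕ) (L : Pred Word 0ℓ) (π₀ : Word)
                  (πs : List Word) : Set where
  field
    input   : L ⊆ S n
    initial : π₀ ∈ L
    {rest}  : List Word
    visits  : πs ≡ π₀ ∷ rest
    run     : Run L [ π₀ ] π₀ rest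

{-# OPTIONS --safe #-}

-- By induction on n. The words of Π R are obtained from those of Π R′ by
-- inserting the value n, and those obtained from one word form a rail. If n is
-- always last, a run for Π R′ is a run for Π R. Otherwise both ends of every
-- rail belong to Π R, and Algorithm J sweeps n through one rail after the
-- other in alternating directions: inside a rail the next word in the
-- direction of the sweep is the only candidate for a jump of n, and at its end
-- n has no candidates, so that the jump of the smaller value is the one made
-- for Π R′. The words list linear extensions, so the arcs leaving n shrink as n
-- moves to the right and a rail is a chain. Projecting a class that lies
-- between two neighbours of a rail into the interval they span shows that the
-- neighbours cover each other in the quotient; between rails a cover of the
-- restricted congruence lifts to both ends, as the restriction of x is the
-- meet of x with c ⊤ and the join of x with c̄ ⊥.

module Submission where

open import Defs
open import Data.Bool.Base using (Bool; true; false; not)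
open import Data.Empty using (⊥-elim-irr)
open import Data.Fin.Base using (Fin; zero; suc; toℕ)
open import Data.Fin.Properties using (any?; toℕ-injective; toℕ<n) renaming (_≟_ to _≟ᶠ_; suc-injective to suc-injectiveᶠ)
open import Data.List.Base using (List; []; _∷_; [_]; _++_; length)
open import Data.List.Membership.DecPropositional using (_∈?_)
open import Data.List.Membership.Propositional using () renaming (_∈_ to _∈ˡ_; _∉_ to _∉ˡ_)
open import Data.List.Membership.Propositional.Properties using (∈-++⁺ˡ; ∈-++⁺ʳ; ∈-++⁻; ∈-insert)
open import Data.List.Properties using (≡-dec; ++-assoc; ++-identityʳ; length-++; ∷-injective; ∷ʳ-injectiveˡ; applyUpTo-∷ʳ)
open import Data.List.Relation.Binary.Permutation.Propositional using (_↭_; ↭-refl; ↭-trans; prep; swap)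
open import Data.List.Relation.Binary.Permutation.Propositional.Properties using (∷↭∷ʳ)
open import Data.List.Relation.Binary.Pointwise using (Pointwise; []; _∷_)
open import Data.List.Relation.Unary.All as All using (All; []; _∷_)
open import Data.List.Relation.Unary.All.Properties using (++⁻ˡ; ++⁻ʳ) renaming (++⁺ to All-++⁺)
open import Data.List.Relation.Unary.AllPairs using (AllPairs; []; _∷_)
open import Data.List.Relation.Unary.Any using (Any; here; there)
open import Data.List.Relation.Unary.Linked using (Linked; [-]; _∷_)
open import Data.Nat.Base using (ℕ; zero; suc; _+_; _∸_; _≤_; _<_; z≤n; s≤s)
open import Data.Nat.Properties
open import Data.Product.Base using (∃; ∃₂; _×_; _,_; proj₁; proj₂)
open import Data.Sum.Base as Sum using (_⊎_; inj₁; inj₂; [_,_]′)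
open import Data.Vec.Base as Vec using (Vec; lookup; tabulate)
open import Data.Vec.Properties using (lookup∘tabulate; lookup-map; tabulate∘lookup; tabulate-cong)
open import Function.Base using (_∘_; id)
open import Function.Bundles using (_⇔_; mk⇔; Equivalence)
open import Level using (0ℓ)
open import Relation.Binary.Construct.Closure.Transitive using (_∷_) renaming ([_] to [_]⁺)
open import Relation.Binary.Core using (Rel)
open import Relation.Binary.PropositionalEquality using (_≡_; _≢_; refl; sym; trans; cong; cong₂; subst; subst₂; module ≡-Reasoning)
open import Relation.Binary.Structures using (IsEquivalence)
open import Relation.Nullary using (¬_; Dec; yes; no; contradiction; does; recompute; _×-dec_; _⊎-dec_)
open import Relation.Unary using (Pred; Decidable; _∈_; _≐_)

-- Jumps and zigzag languages

-- The obstacle is that a step depends on the whole history: `Candidate` excludes the visited words,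
-- so a run for `Π R′` says nothing about `Π R` unless the two lists of visited words are kept in
-- correspondence. The induction therefore carries a `Tour` together with invariants that relate
-- both lists. Nothing classical is available: `R` is an arbitrary predicate, yet a sweep has to
-- decide which positions of n belong to it. The encoding settles this, since a position determines
-- the only rail element that can be encoded there, and `exactly-one` supplies the representative to
-- compare it with. Two symmetries, of join with meet and of source with sink, are absorbed by
-- Booleans. The neighbours of n form a clique, hence a transitive tournament in each acyclic
-- reorientation, and the elements of a rail are its up-sets. Joins and meets are constructed from
-- that description.

ins : ℕ → ℕ → Word → Word
ins N zero    π       = N ∷ π
ins N (suc i) []      = [ N ]
ins N (suc i) (a ∷ π) = a ∷ ins N i π

ins-++ : ∀ {N} xs {ys} → ins N (length xs) (xs ++ ys) ≡ xs ++ N ∷ ys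
ins-++ []       = refl
ins-++ (x ∷ xs) = cong (x ∷_) (ins-++ xs)

ins-end : ∀ {N} π → ins N (length π) π ≡ π ++ [ N ]
ins-end []      = refl
ins-end (a ∷ π) = cong (a ∷_) (ins-end π)

split-at : ∀ {i} (π : Word) → i ≤ length π → ∃₂ λ xs ys → π ≡ xs ++ ys × length xs ≡ i
split-at {zero}  π       _         = [] , π , refl , refl
split-at {suc i} (a ∷ π) (s≤s i≤m) with xs , ys , refl , refl ← split-at π i≤m =
  a ∷ xs , ys , refl , refl

-- It suffices that N avoids the two halves on one side: if the marked occurrences of N differed,
-- one of `xs` and `ys` would contain N.
unique-split : ∀ {N : ℕ} {xs ys xs′ ys′} → N ∉ˡ xs → N ∉ˡ ys →
               xs ++ N ∷ ys ≡ xs′ ++ N ∷ ys′ → xs ≡ xs′ × ys ≡ ys′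
unique-split {xs = []}     {xs′ = []}      _   _   refl = refl , refl
unique-split {xs = []}     {xs′ = x ∷ xs′} _   N∉  refl = contradiction (∈-insert xs′) N∉
unique-split {xs = x ∷ xs} {xs′ = []}      N∉  _   eq   =
  contradiction (here (sym (proj₁ (∷-injective eq)))) N∉
unique-split {xs = x ∷ xs} {xs′ = y ∷ xs′} N∉  N∉′ eq
  with refl , eq′ ← ∷-injective eq
  with refl , refl ← unique-split {xs = xs} (N∉ ∘ there) N∉′ eq′ = refl , refl

snoc-split : ∀ {N : ℕ} (π us : Word) {vs} → π ++ [ N ] ≡ us ++ vs →
             (vs ≡ [] × us ≡ π ++ [ N ]) ⊎ ∃ λ ws → vs ≡ ws ++ [ N ] × π ≡ us ++ ws
snoc-split π       []            refl = inj₂ (π , refl , refl)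
snoc-split []      (u ∷ [])      refl = inj₁ (refl , refl)
snoc-split []      (u ∷ _ ∷ us)  ()
snoc-split (a ∷ π) (u ∷ us)      eq with refl , eq′ ← ∷-injective eq with snoc-split π us eq′
... | inj₁ (refl , refl)          = inj₁ (refl , refl)
... | inj₂ (ws , refl , refl)     = inj₂ (ws , refl , refl)

module _ {N : ℕ} {π : Word} (N∉π : N ∉ˡ π) where

  ins-split : ∀ {i} xs {ys} → i ≤ length π → ins N i π ≡ xs ++ N ∷ ys →
              π ≡ xs ++ ys × i ≡ length xs
  ins-split xs i≤m eq with as , bs , refl , refl ← split-at π i≤m
    with refl , refl ← unique-split (N∉π ∘ ∈-++⁺ˡ) (N∉π ∘ ∈-++⁺ʳ as) (trans (sym (ins-++ as)) eq)
    = refl , refl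

  ins-injective : ∀ {i j} → i ≤ length π → j ≤ length π → ins N i π ≡ ins N j π → i ≡ j
  ins-injective i≤m j≤m eq with as , bs , eq′ , refl ← split-at π j≤m =
    proj₂ (ins-split as i≤m (trans eq (trans (cong (ins N (length as)) eq′) (ins-++ as))))

  -- The inserted N is the only one in the word, so the decomposition given by the jump is the one
  -- at position i and the length of `ys` is the displacement.
  right-jump⁻ : ∀ {i d ρ} → i ≤ length π → Jump right N d (ins N i π) ρ →
                0 < d × i + d ≤ length π × ρ ≡ ins N (i + d) π
  right-jump⁻ i≤m (right xs ys zs refl d>0 _ eq refl)
    with refl , refl ← ins-split xs i≤m eq
    = d>0
    , subst₂ _≤_ (length-++ xs) (cong length (++-assoc xs ys zs))
        (subst (length (xs ++ ys) ≤_) (sym (length-++ (xs ++ ys))) (m≤m+n _ _))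
    , (begin
        xs ++ ys ++ N ∷ zs                             ≡⟨ ++-assoc xs ys (N ∷ zs) ⟨
        (xs ++ ys) ++ N ∷ zs                           ≡⟨ ins-++ (xs ++ ys) ⟨
        ins N (length (xs ++ ys)) ((xs ++ ys) ++ zs)   ≡⟨ cong₂ (ins N) (length-++ xs) (++-assoc xs ys zs) ⟩
        ins N (length xs + length ys) (xs ++ ys ++ zs) ∎)
    where open ≡-Reasoning

  left-jump⁻ : ∀ {i d ρ} → i ≤ length π → Jump left N d (ins N i π) ρ →
               0 < d × ∃ λ j → i ≡ j + d × ρ ≡ ins N j π
  left-jump⁻ i≤m (left xs ys zs refl d>0 _ eq refl)
    with refl , refl ← ins-split (xs ++ ys) i≤m (trans eq (sym (++-assoc xs ys (N ∷ zs))))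
    = d>0 , length xs , length-++ xs
    , trans (sym (ins-++ xs)) (cong (ins N (length xs)) (sym (++-assoc xs ys zs)))

split-at₂ : ∀ i d (π : Word) → i + d ≤ length π →
            ∃ λ xs → ∃₂ λ ys zs → π ≡ xs ++ ys ++ zs × length xs ≡ i × length ys ≡ d
split-at₂ i d π i+d≤m with xs , ts , refl , refl ← split-at {i} π (≤-trans (m≤m+n i d) i+d≤m)
  with ys , zs , refl , refl ← split-at {d} ts
         (+-cancelˡ-≤ (length xs) _ _ (≤-trans i+d≤m (≤-reflexive (length-++ xs))))
  = xs , ys , zs , refl , refl , refl

module _ {N : ℕ} {π : Word} (π<N : All (_< N) π) where

  private
    ins-mid : ∀ xs {ys zs} → ins N (length xs + length ys) (xs ++ ys ++ zs) ≡ xs ++ ys ++ N ∷ zs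
    ins-mid []       {ys} = ins-++ ys
    ins-mid (x ∷ xs)      = cong (x ∷_) (ins-mid xs)

  right-jump⁺ : ∀ {i d} → 0 < d → i + d ≤ length π → Jump right N d (ins N i π) (ins N (i + d) π)
  right-jump⁺ {i} {d} d>0 i+d≤m with xs , ys , zs , refl , refl , refl ← split-at₂ i d π i+d≤m =
    right xs ys zs refl d>0 (++⁻ˡ ys (++⁻ʳ xs π<N)) (ins-++ xs) (ins-mid xs)

  left-jump⁺ : ∀ {i d} → 0 < d → i + d ≤ length π → Jump left N d (ins N (i + d) π) (ins N i π)
  left-jump⁺ {i} {d} d>0 i+d≤m with xs , ys , zs , refl , refl , refl ← split-at₂ i d π i+d≤m =
    left xs ys zs refl d>0 (++⁻ˡ ys (++⁻ʳ xs π<N)) (ins-mid xs) (ins-++ xs)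

-- The positions of N in the order in which moving N in direction δ passes
-- through them.

slot : Direction → ℕ → Word → ℕ → Word
slot right N π i = ins N i π
slot left  N π i = ins N (length π ∸ i) π

-- What a sweep uses of a rail, indexed along its direction so that one argument serves both
-- directions; only indices up to m matter. Of a jump against the direction it is enough to know
-- that it lands at an earlier index.
record IsChain (δ : Direction) (N m : ℕ) (w : ℕ → Word) : Set where
  field
    forward   : ∀ {i d ρ} → i ≤ m → Jump δ N d (w i) ρ → 0 < d × i + d ≤ m × ρ ≡ w (i + d)
    backward  : ∀ {i d ρ} → i ≤ m → Jump (opposite δ) N d (w i) ρ → ∃ λ j → j < i × ρ ≡ w j
    jump      : ∀ {i d} → 0 < d → i + d ≤ m → Jump δ N d (w i) (w (i + d))
    injective : ∀ {i j} → i ≤ m → j ≤ m → w i ≡ w j → i ≡ j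

all<⇒∉ : ∀ {N π} → All (_< N) π → N ∉ˡ π
all<⇒∉ π<N N∈π = <-irrefl refl (All.lookup π<N N∈π)

slot-isChain : ∀ δ {N π} → All (_< N) π → IsChain δ N (length π) (slot δ N π)
slot-isChain right {N} {π} π<N = record
  { forward   = right-jump⁻ N∉π
  ; backward  = λ i≤m J → case-left i≤m (left-jump⁻ N∉π i≤m J)
  ; jump      = right-jump⁺ π<N
  ; injective = ins-injective N∉π
  } where
  N∉π = all<⇒∉ π<N
  case-left : ∀ {i d ρ} → i ≤ length π → 0 < d × (∃ λ j → i ≡ j + d × ρ ≡ ins N j π) →
              ∃ λ j → j < i × ρ ≡ ins N j π
  case-left _ (d>0 , j , refl , eq) = j , m<m+n j d>0 , eq
slot-isChain left {N} {π} π<N = record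
  { forward   = λ {i} i≤m J → fwd i≤m (left-jump⁻ N∉π (m∸n≤m m i) J)
  ; backward  = λ {i} i≤m J → bwd i≤m (right-jump⁻ N∉π (m∸n≤m m i) J)
  ; jump      = λ {i} {d} d>0 i+d≤m →
      subst (λ k → Jump left N d (ins N k π) (ins N (m ∸ (i + d)) π)) (gap i d i+d≤m)
        (left-jump⁺ π<N d>0 (≤-trans (≤-reflexive (gap i d i+d≤m)) (m∸n≤m m i)))
  ; injective = λ {i} {j} i≤m j≤m eq →
      ∸-cancelˡ-≡ i≤m j≤m (ins-injective N∉π (m∸n≤m m i) (m∸n≤m m j) eq)
  } where
  m   = length π
  N∉π = all<⇒∉ π<N
  -- For `left`, indices and positions run in opposite senses; the bound keeps the truncated
  -- subtractions exact.
  gap : ∀ i d → i + d ≤ m → m ∸ (i + d) + d ≡ m ∸ i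
  gap i d i+d≤m = trans (cong (_+ d) (sym (∸-+-assoc m i d)))
    (m∸n+n≡m (≤-trans (≤-reflexive (sym (m+n∸m≡n i d))) (∸-monoˡ-≤ i i+d≤m)))
  fwd : ∀ {i d ρ} → i ≤ m → 0 < d × (∃ λ j → m ∸ i ≡ j + d × ρ ≡ ins N j π) →
        0 < d × i + d ≤ m × ρ ≡ ins N (m ∸ (i + d)) π
  fwd {i} {d} i≤m (d>0 , j , eq , refl) = d>0 , i+d≤m , cong (λ k → ins N k π) (sym lemma)
    where
    i+d≤m : i + d ≤ m
    i+d≤m = ≤-trans (+-monoʳ-≤ i (≤-trans (m≤n+m d j) (≤-reflexive (sym eq)))) (≤-reflexive (m+[n∸m]≡n i≤m))
    lemma : m ∸ (i + d) ≡ j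
    lemma = trans (sym (∸-+-assoc m i d)) (trans (cong (_∸ d) eq) (m+n∸n≡m j d))
  bwd : ∀ {i d ρ} → i ≤ m → 0 < d × m ∸ i + d ≤ m × ρ ≡ ins N (m ∸ i + d) π →
        ∃ λ j → j < i × ρ ≡ ins N (m ∸ j) π
  bwd {i} {d} i≤m (d>0 , le , refl) = m ∸ k , j<i , cong (λ k → ins N k π) (sym (m∸[m∸n]≡n le))
    where
    k = m ∸ i + d
    j<i : m ∸ k < i
    j<i = subst (m ∸ k <_) (m∸[m∸n]≡n i≤m) (∸-monoʳ-< (m<m+n (m ∸ i) d>0) le)

-- Jumps of smaller values while N stands at an end

jump-∈ : ∀ {δ b d π ρ} → Jump δ b d π ρ → b ∈ˡ π
jump-∈ (right xs ys zs _ _ _ refl _) = ∈-insert xs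
jump-∈ (left  xs ys zs _ _ _ refl _) = ∈-++⁺ʳ xs (∈-insert ys)

-- N at the end of the word that it reaches by moving in direction δ.

ext : Direction → ℕ → Word → Word
ext right N π = π ++ [ N ]
ext left  N π = N ∷ π

ext-jump⁺ : ∀ e {δ N b d π ρ} → Jump δ b d π ρ → Jump δ b d (ext e N π) (ext e N ρ)
ext-jump⁺ left  (right xs ys zs l d>0 ys< refl refl) = right (_ ∷ xs) ys zs l d>0 ys< refl refl
ext-jump⁺ left  (left  xs ys zs l d>0 ys< refl refl) = left  (_ ∷ xs) ys zs l d>0 ys< refl refl
ext-jump⁺ right {N = N} (right {a} xs ys zs l d>0 ys< refl refl) =
  right xs ys (zs ++ [ N ]) l d>0 ys<
    (trans (++-assoc xs (a ∷ ys ++ zs) [ N ]) (cong (λ ts → xs ++ a ∷ ts) (++-assoc ys zs [ N ])))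
    (trans (++-assoc xs (ys ++ a ∷ zs) [ N ]) (cong (xs ++_) (++-assoc ys (a ∷ zs) [ N ])))
ext-jump⁺ right {N = N} (left {a} xs ys zs l d>0 ys< refl refl) =
  left xs ys (zs ++ [ N ]) l d>0 ys<
    (trans (++-assoc xs (ys ++ a ∷ zs) [ N ]) (cong (xs ++_) (++-assoc ys (a ∷ zs) [ N ])))
    (trans (++-assoc xs (a ∷ ys ++ zs) [ N ]) (cong (λ ts → xs ++ a ∷ ts) (++-assoc ys zs [ N ])))

ext-∈⁻ : ∀ e {N b π} → b ∈ˡ ext e N π → b ≡ N ⊎ b ∈ˡ π
ext-∈⁻ left      (here eq)  = inj₁ eq
ext-∈⁻ left      (there b∈) = inj₂ b∈
ext-∈⁻ right {π = π} b∈ with ∈-++⁻ π b∈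
... | inj₁ b∈π       = inj₂ b∈π
... | inj₂ (here eq) = inj₁ eq

module _ {N : ℕ} {π : Word} (π<N : All (_< N) π) where

  ext-jump-< : ∀ e {δ b d ρ} → b ≢ N → Jump δ b d (ext e N π) ρ → b < N
  ext-jump-< e b≢N J = [ (λ eq → contradiction eq b≢N) , All.lookup π<N ]′ (ext-∈⁻ e (jump-∈ J))

  -- A jump of b passes only values smaller than b, and b < N, so b cannot pass N. As N stands at an
  -- end of the word, the jump takes place inside π.
  ext-jump⁻ : ∀ e {δ b d ρ} → b ≢ N → Jump δ b d (ext e N π) ρ →
              ∃ λ σ → ρ ≡ ext e N σ × Jump δ b d π σ
  ext-jump⁻ e b≢N J with ext-jump-< e b≢N J
  ext-jump⁻ left b≢N (right [] ys zs l d>0 ys< refl refl) | _ = contradiction refl b≢N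
  ext-jump⁻ left b≢N (right (_ ∷ xs) ys zs l d>0 ys< refl refl) | _ =
    _ , refl , right xs ys zs l d>0 ys< refl refl
  ext-jump⁻ left b≢N (left [] [] zs refl () ys< refl refl) | _
  ext-jump⁻ left b≢N (left [] (y ∷ ys) zs l d>0 (y<b ∷ ys<) refl refl) | b<N =
    contradiction y<b (<-asym b<N)
  ext-jump⁻ left b≢N (left (_ ∷ xs) ys zs l d>0 ys< refl refl) | _ =
    _ , refl , left xs ys zs l d>0 ys< refl refl
  ext-jump⁻ right {b = b} b≢N (right xs ys zs l d>0 ys< eq refl) | b<N
    with snoc-split π (xs ++ b ∷ ys) (trans eq (sym (++-assoc xs (b ∷ ys) zs)))
  ... | inj₂ (ws , refl , refl) = _
      , trans (cong (xs ++_) (sym (++-assoc ys (b ∷ ws) [ N ]))) (sym (++-assoc xs (ys ++ b ∷ ws) [ N ]))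
      , right xs ys ws l d>0 ys< (++-assoc xs (b ∷ ys) ws) refl
  ... | inj₁ (refl , eq′) with snoc-split π xs (sym eq′)
  ...   | inj₂ ([] , refl , refl)      = contradiction refl b≢N
  ...   | inj₂ (_ ∷ ws , refl , refl)  =
    contradiction (All.lookup ys< (∈-insert ws)) (<-asym b<N)
  ext-jump⁻ right {b = b} b≢N (left xs ys zs l d>0 ys< eq refl) | b<N
    with snoc-split π (xs ++ ys) (trans eq (sym (++-assoc xs ys (b ∷ zs))))
  ... | inj₂ ([] , refl , refl)     = contradiction refl b≢N
  ... | inj₂ (_ ∷ ws , refl , refl) = _
      , trans (cong (λ ts → xs ++ b ∷ ts) (sym (++-assoc ys ws [ N ])))
              (sym (++-assoc xs (b ∷ ys ++ ws) [ N ]))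
      , left xs ys ws l d>0 ys< (++-assoc xs ys (b ∷ ws)) refl

-- The words of `L` with N at the end e form a copy of `L′`, and the visited lists correspond. Once
-- N has no candidate it cannot pre-empt a smaller value; shorter jumps correspond as well, so
-- minimality, halting and steps at π carry over.
module Lift {N : ℕ} {L L′ : Pred Word 0ℓ} (letters : ∀ {σ} → L′ σ → All (_< N) σ)
            (e : Direction) {visited visited′ : List Word}
            (up       : ∀ {σ} → L′ σ → L (ext e N σ))
            (down     : ∀ {σ} → L (ext e N σ) → L′ σ)
            (vis-up   : ∀ {σ} → L′ σ → σ ∈ˡ visited′ → ext e N σ ∈ˡ visited)
            (vis-down : ∀ {σ} → L′ σ → ext e N σ ∈ˡ visited → σ ∈ˡ visited′)
            {π : Word} (π∈L′ : L′ π)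
            (no-N : ∀ {δ ρ} → ¬ Candidate L visited δ N (ext e N π) ρ)
            where

  candidate⁺ : ∀ {δ b ρ} → Candidate L′ visited′ δ b π ρ →
               Candidate L visited δ b (ext e N π) (ext e N ρ)
  candidate⁺ {b = b} ((d , J , min) , ρ∈L′ , ρ∉) =
    (d , ext-jump⁺ e J , min′) , up ρ∈L′ , λ ρ∈ → ρ∉ (vis-down ρ∈L′ ρ∈)
    where
    b≢N : b ≢ N
    b≢N refl = all<⇒∉ (letters π∈L′) (jump-∈ J)
    min′ : ∀ d′ ρ′ → d′ < d → Jump _ b d′ (ext e N π) ρ′ → ¬ L ρ′
    min′ d′ ρ′ d′<d J′ ρ′∈L with σ , refl , J″ ← ext-jump⁻ (letters π∈L′) e b≢N J′ =
      min d′ σ d′<d J″ (down ρ′∈L)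

  candidate⁻ : ∀ {δ b ρ} → Candidate L visited δ b (ext e N π) ρ →
               ∃ λ σ → ρ ≡ ext e N σ × Candidate L′ visited′ δ b π σ
  candidate⁻ {δ} {b} C@((d , J , min) , ρ∈L , ρ∉) with b ≟ N
  ... | yes refl = contradiction C no-N
  ... | no b≢N with σ , refl , J′ ← ext-jump⁻ (letters π∈L′) e b≢N J =
    σ , refl , (d , J′ , λ d′ τ d′<d J″ τ∈L′ → min d′ (ext e N τ) d′<d (ext-jump⁺ e J″) (up τ∈L′))
      , down ρ∈L , λ σ∈ → ρ∉ (vis-up (down ρ∈L) σ∈)

  largest⁺ : ∀ {b} → IsLargest L′ visited′ b π → IsLargest L visited b (ext e N π)
  largest⁺ ((δ , ρ , C) , max) =
    (δ , ext e N ρ , candidate⁺ C) , λ b δ ρ C → max b δ _ (proj₂ (proj₂ (candidate⁻ C)))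

  step⁺ : ∀ {ρ} → Step L′ visited′ π ρ → Step L visited (ext e N π) (ext e N ρ)
  step⁺ (δ , b , max , C , unique) =
    δ , b , largest⁺ max , candidate⁺ C , λ ρ C → unique _ (proj₂ (proj₂ (candidate⁻ C)))

  halt⁺ : NoJump L′ visited′ π ⊎ Ambiguous L′ visited′ π →
          NoJump L visited (ext e N π) ⊎ Ambiguous L visited (ext e N π)
  halt⁺ (inj₁ stop) = inj₁ λ δ b ρ C → stop δ b _ (proj₂ (proj₂ (candidate⁻ C)))
  halt⁺ (inj₂ (b , max , amb)) =
    inj₂ (b , largest⁺ max , λ δ → _ , candidate⁺ (proj₂ (amb δ)))

-- A run over all of `L` whose steps satisfy `Cov`. The words still to come are no index, as the
-- inductions only track what has been visited; `visits` extracts them. Exhaustion of `L` is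
-- recorded at the halt and thus proved along with the run.
data Tour (L : Pred Word 0ℓ) (Cov : Rel Word 0ℓ) (visited : List Word) (π : Word) : Set where
  halt : NoJump L visited π ⊎ Ambiguous L visited π →
         (∀ {ρ} → L ρ → ρ ∈ˡ visited) → Tour L Cov visited π
  step : ∀ {ρ} → Step L visited π ρ → Cov π ρ → Tour L Cov (ρ ∷ visited) ρ →
         Tour L Cov visited π

module _ {δ N m w} (chain : IsChain δ N m w) {L : Pred Word 0ℓ} {Cov : Rel Word 0ℓ}
         (L?      : ∀ {i} → i ≤ m → Dec (L (w i)))
         (end∈L   : L (w m))
         (letters : ∀ {i b} → b ∈ˡ w i → b ≤ N)
         (cov     : ∀ {i j} → i < j → j ≤ m → L (w i) → L (w j) →
                    (∀ {k} → i < k → k < j → ¬ L (w k)) → Cov (w i) (w j))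
         where

  open IsChain chain

  private
    -- All letters are at most N, so a candidate for N is one of the largest value. The words behind
    -- i are visited, which rules out the opposite direction and hence ambiguity; `gap` makes the
    -- jump minimal.
    rail-step : ∀ {visited i j} → i < j → j ≤ m → L (w j) →
                (∀ {k} → i < k → k < j → ¬ L (w k)) → w j ∉ˡ visited →
                (∀ {k} → k ≤ i → L (w k) → w k ∈ˡ visited) →
                Step L visited (w i) (w j)
    rail-step {visited} {i} {j} i<j j≤m Lj gap j∉ behind =
      δ , N , ((δ , w j , next) , λ b δ ρ ((_ , J , _) , _) → letters (jump-∈ J)) , next , back
      where
      d = j ∸ i
      i+d≡j : i + d ≡ j
      i+d≡j = m+[n∸m]≡n (<⇒≤ i<j)
      i≤m : i ≤ m
      i≤m = ≤-trans (<⇒≤ i<j) j≤m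
      next : Candidate L visited δ N (w i) (w j)
      next = (d , subst (λ k → Jump δ N d (w i) (w k)) i+d≡j
                    (jump (m<n⇒0<n∸m i<j) (≤-trans (≤-reflexive i+d≡j) j≤m))
                , min) , Lj , j∉
        where
        min : ∀ d′ ρ → d′ < d → Jump δ N d′ (w i) ρ → ¬ L ρ
        min d′ ρ d′<d J Lρ with d′>0 , _ , refl ← forward i≤m J =
          gap (m<m+n i d′>0) (subst (i + d′ <_) i+d≡j (+-monoʳ-< i d′<d)) Lρ
      back : ∀ ρ → ¬ Candidate L visited (opposite δ) N (w i) ρ
      back ρ ((_ , J , _) , Lρ , ρ∉) with k , k<i , refl ← backward i≤m J =
        ρ∉ (behind (<⇒≤ k<i) Lρ)

    ∈-∷-behind : ∀ {visited i j} → (∀ {k} → i < k → k < j → ¬ L (w k)) →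
                 (∀ {k} → k ≤ i → L (w k) → w k ∈ˡ visited) →
                 ∀ {k} → k ≤ j → L (w k) → w k ∈ˡ w j ∷ visited
    ∈-∷-behind {i = i} gap behind {k} k≤j Lk with m≤n⇒m<n∨m≡n k≤j
    ... | inj₂ refl = here refl
    ... | inj₁ k<j with <-≤-connex i k
    ...   | inj₁ i<k = contradiction Lk (gap i<k k<j)
    ...   | inj₂ k≤i = there (behind k≤i Lk)

    -- f counts the positions from j on that are still to be examined.

    walk : ∀ f {i j visited} → j + f ≡ suc m → i < j → i ≤ m → L (w i) →
           (∀ {k} → i < k → k < j → ¬ L (w k)) →
           (∀ {k} → i < k → k ≤ m → w k ∉ˡ visited) →
           (∀ {k} → k ≤ i → L (w k) → w k ∈ˡ visited) →
           (∀ {visited′} → (∀ {k} → k ≤ m → L (w k) → w k ∈ˡ visited′) →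
              (∀ {ρ} → ρ ∈ˡ visited → ρ ∈ˡ visited′) →
              (∀ {ρ} → ρ ∈ˡ visited′ → ρ ∈ˡ visited ⊎ ∃ λ k → k ≤ m × ρ ≡ w k) →
              Tour L Cov visited′ (w m)) →
           Tour L Cov visited (w i)
    -- No position remains, so j is `suc m`. As the last position belongs to `L`, the gap between i
    -- and j leaves only i = m.
    walk zero {i} {j} eq i<j i≤m Li gap ahead behind continue
      with refl ← trans (sym (+-identityʳ j)) eq with m≤n⇒m<n∨m≡n i≤m
    ... | inj₁ i<m  = contradiction end∈L (gap i<m ≤-refl)
    ... | inj₂ refl = continue behind id inj₁
    walk (suc f) {i} {j} {visited} eq i<j i≤m Li gap ahead behind continue with L? j≤m
      where
      j≤m : j ≤ m
      j≤m = m+n≤o⇒m≤o j (≤-reflexive (suc-injective (trans (sym (+-suc j f)) eq)))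
    ... | no ¬Lj = walk f (trans (sym (+-suc j f)) eq) (m<n⇒m<1+n i<j) i≤m Li gap′ ahead behind continue
      where
      gap′ : ∀ {k} → i < k → k < suc j → ¬ L (w k)
      gap′ i<k (s≤s k≤j) with m≤n⇒m<n∨m≡n k≤j
      ... | inj₁ k<j  = gap i<k k<j
      ... | inj₂ refl = ¬Lj
    ... | yes Lj =
      step (rail-step i<j j≤m Lj gap (ahead i<j j≤m) behind) (cov i<j j≤m Li Lj gap)
        (walk f (trans (sym (+-suc j f)) eq) ≤-refl j≤m Lj
          (λ j<k k<1+j → contradiction j<k (≤⇒≯ (≤-pred k<1+j)))
          ahead′ (∈-∷-behind gap behind)
          λ all old new → continue all (old ∘ there) ([ new′ , inj₂ ]′ ∘ new))
      where
      j≤m : j ≤ m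
      j≤m = m+n≤o⇒m≤o j (≤-reflexive (suc-injective (trans (sym (+-suc j f)) eq)))
      ahead′ : ∀ {k} → j < k → k ≤ m → w k ∉ˡ w j ∷ visited
      ahead′ j<k k≤m (here eq)  = <⇒≢ j<k (sym (injective k≤m j≤m eq))
      ahead′ j<k k≤m (there k∈) = ahead (<-trans i<j j<k) k≤m k∈
      new′ : ∀ {ρ} → ρ ∈ˡ w j ∷ visited → ρ ∈ˡ visited ⊎ ∃ λ k → k ≤ m × ρ ≡ w k
      new′ (here refl) = inj₂ (j , j≤m , refl)
      new′ (there ρ∈)  = inj₁ ρ∈

  -- In continuation-passing form, because which words are swept is known only through `L?`. The
  -- continuation learns that the enlarged list contains the words of the rail in `L`, keeps the old
  -- words and gains nothing off the rail.
  traverse : ∀ {visited} → L (w 0) → w 0 ∈ˡ visited →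
             (∀ {k} → 0 < k → k ≤ m → w k ∉ˡ visited) →
             (∀ {visited′} → (∀ {k} → k ≤ m → L (w k) → w k ∈ˡ visited′) →
                (∀ {ρ} → ρ ∈ˡ visited → ρ ∈ˡ visited′) →
                (∀ {ρ} → ρ ∈ˡ visited′ → ρ ∈ˡ visited ⊎ ∃ λ k → k ≤ m × ρ ≡ w k) →
                Tour L Cov visited′ (w m)) →
             Tour L Cov visited (w 0)
  traverse L0 0∈ ahead = walk m refl (s≤s z≤n) z≤n L0
    (λ 0<k k<1 → contradiction 0<k (≤⇒≯ (≤-pred k<1))) ahead (λ { z≤n _ → 0∈ })

module _ {N : ℕ} {L L′ : Pred Word 0ℓ} {Cov Cov′ : Rel Word 0ℓ}
         (letters : ∀ {σ} → L′ σ → All (_< N) σ)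
         (cov-snoc : ∀ {σ τ} → L′ σ → L′ τ → Cov′ σ τ → Cov (σ ++ [ N ]) (τ ++ [ N ]))
         where

  -- Every word of `L` ends in N, so moving N away from the end leaves `L`. Hence N never has a
  -- candidate, and each step is lifted with N at the right end.
  tour-append : (∀ {σ} → L′ σ → L (σ ++ [ N ])) →
                (∀ {ρ} → L ρ → ∃ λ σ → ρ ≡ σ ++ [ N ] × L′ σ) →
                ∀ {visited visited′ π} → L′ π →
                (∀ {σ} → L′ σ → σ ∈ˡ visited′ → σ ++ [ N ] ∈ˡ visited) →
                (∀ {σ} → L′ σ → σ ++ [ N ] ∈ˡ visited → σ ∈ˡ visited′) →
                Tour L′ Cov′ visited′ π → Tour L Cov visited (π ++ [ N ])
  tour-append up L⇒ {visited} {visited′} {π} π∈L′ vis-up vis-down = go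
    where
    down : ∀ {σ} → L (σ ++ [ N ]) → L′ σ
    down ρ∈L with τ , eq , τ∈L′ ← L⇒ ρ∈L with refl ← ∷ʳ-injectiveˡ _ τ eq = τ∈L′
    no-N : ∀ {δ ρ} → ¬ Candidate L visited δ N (π ++ [ N ]) ρ
    no-N {right} {ρ} ((d , J , _) , _) with π<N ← letters π∈L′
      with d>0 , le , _ ← right-jump⁻ (all<⇒∉ π<N) ≤-refl
             (subst (λ τ → Jump right N d τ ρ) (sym (ins-end π)) J) =
      <⇒≱ (m<m+n (length π) d>0) le
    no-N {left} {ρ} ((d , J , _) , ρ∈L , _) with N∉π ← all<⇒∉ (letters π∈L′)
      with d>0 , j , eq , refl ← left-jump⁻ N∉π ≤-refl
             (subst (λ τ → Jump left N d τ ρ) (sym (ins-end π)) J)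
      -- A word of `L` has N last, which forces j to be the length of π and contradicts d > 0.
      with σ , eq′ , _ ← L⇒ ρ∈L
      with refl , refl ← ins-split N∉π {j} σ (m+n≤o⇒m≤o j (≤-reflexive (sym eq))) eq′ =
      <⇒≢ (m<m+n (length σ) d>0) (trans (cong length (sym (++-identityʳ σ))) eq)
    open Lift letters right up down vis-up vis-down π∈L′ no-N
    go : Tour L′ Cov′ visited′ π → Tour L Cov visited (π ++ [ N ])
    go (halt stop complete) = halt (halt⁺ stop) λ ρ∈L → complete′ (L⇒ ρ∈L)
      where
      complete′ : ∀ {ρ} → (∃ λ σ → ρ ≡ σ ++ [ N ] × L′ σ) → ρ ∈ˡ visited
      complete′ (σ , refl , σ∈L′) = vis-up σ∈L′ (complete σ∈L′)
    go (step {ρ} s@(_ , _ , _ , (_ , ρ∈L′ , _) , _) cov t) =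
      step (step⁺ s) (cov-snoc π∈L′ ρ∈L′ cov)
        (tour-append up L⇒ ρ∈L′
          (λ { _ (here refl) → here refl ; σ∈L′ (there σ∈) → there (vis-up σ∈L′ σ∈) })
          (λ { {σ} _ (here eq) → here (∷ʳ-injectiveˡ σ ρ eq)
             ; σ∈L′ (there σ∈) → there (vis-down σ∈L′ σ∈) })
          t)

-- Sweeping the rails of a language

slot-first : ∀ δ N π → slot δ N π 0 ≡ ext (opposite δ) N π
slot-first right N π = refl
slot-first left  N π = ins-end π

slot-last : ∀ δ N π → slot δ N π (length π) ≡ ext δ N π
slot-last right N π = ins-end π
slot-last left  N π = cong (λ i → ins N i π) (n∸n≡0 (length π))

slot-ins : ∀ δ N π {i} → i ≤ length π → ∃ λ j → j ≤ length π × slot δ N π i ≡ ins N j π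
slot-ins right N π {i} i≤m = i , i≤m , refl
slot-ins left  N π {i} i≤m = length π ∸ i , m∸n≤m (length π) i , refl

ins-slot : ∀ δ N π {i} → i ≤ length π → ∃ λ j → j ≤ length π × ins N i π ≡ slot δ N π j
ins-slot right N π {i} i≤m = i , i≤m , refl
ins-slot left  N π {i} i≤m =
  length π ∸ i , m∸n≤m (length π) i , cong (λ k → ins N k π) (sym (m∸[m∸n]≡n i≤m))

ext-ins : ∀ e N π → ∃ λ i → i ≤ length π × ext e N π ≡ ins N i π
ext-ins right N π = length π , ≤-refl , sym (ins-end π)
ext-ins left  N π = 0 , z≤n , refl

ins-base : ∀ {N i j σ τ} → N ∉ˡ σ → i ≤ length σ → j ≤ length τ → ins N i σ ≡ ins N j τ → σ ≡ τ
ins-base {τ = τ} N∉σ i≤m j≤m eq with as , bs , refl , refl ← split-at τ j≤m =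
  proj₁ (ins-split N∉σ as i≤m (trans eq (ins-++ as)))

ins-∈ : ∀ {N b} i π → b ∈ˡ ins N i π → b ≡ N ⊎ b ∈ˡ π
ins-∈ zero    π       (here eq)  = inj₁ eq
ins-∈ zero    π       (there b∈) = inj₂ b∈
ins-∈ (suc i) []      (here eq)  = inj₁ eq
ins-∈ (suc i) (a ∷ π) (here eq)  = inj₂ (here eq)
ins-∈ (suc i) (a ∷ π) (there b∈) = Sum.map₂ there (ins-∈ i π b∈)

opposite-involutive : ∀ e → opposite (opposite e) ≡ e
opposite-involutive left  = refl
opposite-involutive right = refl

module _ {N : ℕ} {L L′ : Pred Word 0ℓ} {Cov Cov′ : Rel Word 0ℓ}
         (letters  : ∀ {σ} → L′ σ → All (_< N) σ)
         (cov-ext  : ∀ e {σ τ} → L′ σ → L′ τ → Cov′ σ τ → Cov (ext e N σ) (ext e N τ))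
         (L⇒       : ∀ {ρ} → L ρ → ∃₂ λ i σ → i ≤ length σ × ρ ≡ ins N i σ × L′ σ)
         (ends     : ∀ e {σ} → L′ σ → L (ext e N σ))
         (L?       : ∀ {σ i} → L′ σ → i ≤ length σ → Dec (L (ins N i σ)))
         (cov-rail : ∀ {σ i j} → L′ σ → i < j → j ≤ length σ → L (ins N i σ) → L (ins N j σ) →
                     (∀ {k} → i < k → k < j → ¬ L (ins N k σ)) →
                     Cov (ins N i σ) (ins N j σ) × Cov (ins N j σ) (ins N i σ))
         where

  private
    down-ext : ∀ e {σ} → L (ext e N σ) → L′ σ
    down-ext left {σ} ρ∈L with j , τ , j≤m , eq , τ∈L′ ← L⇒ ρ∈L
      with refl ← ins-base (all<⇒∉ (letters τ∈L′)) j≤m z≤n (sym eq) = τ∈L′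
    down-ext right {σ} ρ∈L with j , τ , j≤m , eq , τ∈L′ ← L⇒ ρ∈L
      with refl ← ins-base (all<⇒∉ (letters τ∈L′)) j≤m ≤-refl (sym (trans (ins-end σ) eq)) = τ∈L′

    slot-cov : ∀ δ {σ i j} → L′ σ → i < j → j ≤ length σ →
               L (slot δ N σ i) → L (slot δ N σ j) →
               (∀ {k} → i < k → k < j → ¬ L (slot δ N σ k)) →
               Cov (slot δ N σ i) (slot δ N σ j)
    slot-cov right σ∈L′ i<j j≤m Li Lj gap = proj₁ (cov-rail σ∈L′ i<j j≤m Li Lj gap)
    slot-cov left {σ} {i} {j} σ∈L′ i<j j≤m Li Lj gap =
      proj₂ (cov-rail σ∈L′ (∸-monoʳ-< i<j j≤m) (m∸n≤m m i) Lj Li gap′)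
      where
      m = length σ
      gap′ : ∀ {k} → m ∸ j < k → k < m ∸ i → ¬ L (ins N k σ)
      gap′ {k} lo hi = subst (λ l → ¬ L (ins N l σ)) (m∸[m∸n]≡n k≤m)
        (gap (subst (_< m ∸ k) (m∸[m∸n]≡n (≤-trans (<⇒≤ i<j) j≤m)) (∸-monoʳ-< hi (m∸n≤m m i)))
             (subst (m ∸ k <_) (m∸[m∸n]≡n j≤m) (∸-monoʳ-< lo k≤m)))
        where
        k≤m : k ≤ m
        k≤m = ≤-trans (<⇒≤ hi) (m∸n≤m m i)

  -- The invariants tie the two lists together: rails of the other visited words are finished
  -- (`done`), no rail of an unvisited word has been touched (`known`), and the rail of π has been
  -- entered only at the end opposite to e (`fresh`).
  tour-zigzag : ∀ e {visited visited′ π} → L′ π → π ∈ˡ visited′ →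
                ext (opposite e) N π ∈ˡ visited →
                (∀ {σ i} → L′ σ → σ ∈ˡ visited′ → σ ≢ π → i ≤ length σ →
                   L (ins N i σ) → ins N i σ ∈ˡ visited) →
                (∀ {σ i} → L′ σ → i ≤ length σ → ins N i σ ∈ˡ visited → σ ∈ˡ visited′) →
                (∀ {i} → i ≤ length π → ins N i π ∈ˡ visited → ins N i π ≡ ext (opposite e) N π) →
                Tour L′ Cov′ visited′ π → Tour L Cov visited (ext (opposite e) N π)
  tour-zigzag e {visited} {visited′} {π} π∈L′ π∈ start∈ done known fresh tour =
    subst (Tour L Cov visited) (slot-first e N π)
      (traverse chain slot? (subst L (sym (slot-last e N π)) (ends e π∈L′)) slot-letters
        (slot-cov e π∈L′) (subst L (sym (slot-first e N π)) (ends (opposite e) π∈L′))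
        (subst (_∈ˡ visited) (sym (slot-first e N π)) start∈) ahead
        λ {V} all old new → subst (Tour L Cov V) (sym (slot-last e N π)) (continue all old new tour))
    where
    m = length π
    chain : IsChain e N m (slot e N π)
    chain = slot-isChain e (letters π∈L′)
    slot? : ∀ {i} → i ≤ m → Dec (L (slot e N π i))
    slot? i≤m with j , j≤m , eq ← slot-ins e N π i≤m = subst (λ ρ → Dec (L ρ)) (sym eq) (L? π∈L′ j≤m)
    slot-letters : ∀ {i b} → b ∈ˡ slot e N π i → b ≤ N
    slot-letters {i} b∈ = [ (λ { refl → ≤-refl }) , (λ b∈π → <⇒≤ (All.lookup (letters π∈L′) b∈π)) ]′
                          (ins-or e b∈)
      where
      ins-or : ∀ e {b} → b ∈ˡ slot e N π i → b ≡ N ⊎ b ∈ˡ π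
      ins-or right = ins-∈ i π
      ins-or left  = ins-∈ (m ∸ i) π
    ahead : ∀ {k} → 0 < k → k ≤ m → slot e N π k ∉ˡ visited
    ahead 0<k k≤m k∈ with j , j≤m , eq ← slot-ins e N π k≤m =
      <⇒≢ 0<k (sym (IsChain.injective chain k≤m z≤n
        (trans eq (trans (fresh j≤m (subst (_∈ˡ visited) eq k∈)) (sym (slot-first e N π))))))
    continue : ∀ {V} → (∀ {k} → k ≤ m → L (slot e N π k) → slot e N π k ∈ˡ V) →
               (∀ {ρ} → ρ ∈ˡ visited → ρ ∈ˡ V) →
               (∀ {ρ} → ρ ∈ˡ V → ρ ∈ˡ visited ⊎ ∃ λ k → k ≤ m × ρ ≡ slot e N π k) →
               Tour L′ Cov′ visited′ π → Tour L Cov V (ext e N π)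
    continue {V} all old new = go
      where
      on-rail : ∀ {i} → i ≤ m → L (ins N i π) → ins N i π ∈ˡ V
      on-rail i≤m ρ∈L with j , j≤m , eq ← ins-slot e N π i≤m =
        subst (_∈ˡ V) (sym eq) (all j≤m (subst L eq ρ∈L))
      done′ : ∀ {σ i} → L′ σ → σ ∈ˡ visited′ → i ≤ length σ → L (ins N i σ) → ins N i σ ∈ˡ V
      done′ {σ} σ∈L′ σ∈ i≤m ρ∈L with ≡-dec _≟_ σ π
      ... | yes refl = on-rail i≤m ρ∈L
      ... | no σ≢π   = old (done σ∈L′ σ∈ σ≢π i≤m ρ∈L)
      known′ : ∀ {σ i} → L′ σ → i ≤ length σ → ins N i σ ∈ˡ V → σ ∈ˡ visited′
      known′ σ∈L′ i≤m ρ∈ with new ρ∈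
      ... | inj₁ ρ∈visited = known σ∈L′ i≤m ρ∈visited
      ... | inj₂ (k , k≤m , eq) with j , j≤m , eq′ ← slot-ins e N π k≤m
        with refl ← ins-base (all<⇒∉ (letters σ∈L′)) i≤m j≤m (trans eq eq′) = π∈
      vis-up : ∀ {σ} → L′ σ → σ ∈ˡ visited′ → ext e N σ ∈ˡ V
      vis-up {σ} σ∈L′ σ∈ with i , i≤m , eq ← ext-ins e N σ =
        subst (_∈ˡ V) (sym eq) (done′ σ∈L′ σ∈ i≤m (subst L eq (ends e σ∈L′)))
      vis-down : ∀ {σ} → L′ σ → ext e N σ ∈ˡ V → σ ∈ˡ visited′
      vis-down {σ} σ∈L′ ρ∈ with i , i≤m , eq ← ext-ins e N σ =
        known′ σ∈L′ i≤m (subst (_∈ˡ V) eq ρ∈)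
      -- A jump of N stays on the rail of π, and all words of `L` on this rail are visited by now.
      no-N : ∀ {δ ρ} → ¬ Candidate L V δ N (ext e N π) ρ
      no-N {right} {ρ} ((d , J , _) , ρ∈L , ρ∉) with i , i≤m , eq ← ext-ins e N π
        with _ , le , refl ← right-jump⁻ (all<⇒∉ (letters π∈L′)) i≤m
               (subst (λ τ → Jump right N d τ ρ) eq J) =
        ρ∉ (on-rail le ρ∈L)
      no-N {left} {ρ} ((d , J , _) , ρ∈L , ρ∉) with i , i≤m , eq ← ext-ins e N π
        with _ , j , refl , refl ← left-jump⁻ (all<⇒∉ (letters π∈L′)) i≤m
               (subst (λ τ → Jump left N d τ ρ) eq J) =
        ρ∉ (on-rail (m+n≤o⇒m≤o j i≤m) ρ∈L)
      open Lift {L = L} letters e (ends e) (down-ext e) vis-up vis-down π∈L′ no-N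
      go : Tour L′ Cov′ visited′ π → Tour L Cov V (ext e N π)
      go (halt stop complete) = halt (halt⁺ stop) complete′
        where
        complete′ : ∀ {ρ} → L ρ → ρ ∈ˡ V
        complete′ ρ∈L with i , σ , i≤m , refl , σ∈L′ ← L⇒ ρ∈L =
          done′ σ∈L′ (complete σ∈L′) i≤m ρ∈L
      go (step {τ} s@(_ , _ , _ , (_ , τ∈L′ , τ∉) , _) cov t) =
        step (step⁺ s) (cov-ext e π∈L′ τ∈L′ cov)
          -- The next rail is entered at the end where N stands, so the sweep reverses and the two
          -- opposites cancel.
          (subst (λ δ → Tour L Cov (ext e N τ ∷ V) (ext δ N τ)) (opposite-involutive e)
            (tour-zigzag (opposite e) τ∈L′ (here refl)
              (subst (λ δ → ext δ N τ ∈ˡ ext e N τ ∷ V) (sym (opposite-involutive e)) (here refl))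
              (λ { _ (here eq) σ≢τ → contradiction eq σ≢τ
                 ; σ∈L′ (there σ∈) _ i≤m ρ∈L → there (done′ σ∈L′ σ∈ i≤m ρ∈L) })
              known″ fresh″ t))
        where
        known″ : ∀ {σ i} → L′ σ → i ≤ length σ → ins N i σ ∈ˡ ext e N τ ∷ V → σ ∈ˡ τ ∷ visited′
        known″ σ∈L′ i≤m (there ρ∈) = there (known′ σ∈L′ i≤m ρ∈)
        known″ σ∈L′ i≤m (here eq) with j , j≤m , eq′ ← ext-ins e N τ =
          here (ins-base (all<⇒∉ (letters σ∈L′)) i≤m j≤m (trans eq eq′))
        fresh″ : ∀ {i} → i ≤ length τ → ins N i τ ∈ˡ ext e N τ ∷ V →
                 ins N i τ ≡ ext (opposite (opposite e)) N τ
        fresh″ i≤m (here eq)  = trans eq (cong (λ δ → ext δ N τ) (sym (opposite-involutive e)))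
        -- An earlier word on the rail of τ would mean that τ had been visited before.
        fresh″ i≤m (there ρ∈) = contradiction (known′ τ∈L′ i≤m ρ∈) τ∉

-- Acyclic reorientations

mark : Bool → Link
mark true  = out
mark false = inn

_≟ˡ_ : (l m : Link) → Dec (l ≡ m)
none ≟ˡ none = yes refl
none ≟ˡ out  = no λ ()
none ≟ˡ inn  = no λ ()
out  ≟ˡ none = no λ ()
out  ≟ˡ out  = yes refl
out  ≟ˡ inn  = no λ ()
inn  ≟ˡ none = no λ ()
inn  ≟ˡ out  = no λ ()
inn  ≟ˡ inn  = yes refl

reverse-mark : ∀ b → reverse (mark b) ≡ mark (not b)
reverse-mark true  = refl
reverse-mark false = refl

mark≢not : ∀ b → mark b ≢ mark (not b)
mark≢not true  ()
mark≢not false ()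

mark≢none : ∀ b → mark b ≢ none
mark≢none true  ()
mark≢none false ()

not-marked : ∀ b {l} → l ≢ none → l ≢ mark b → l ≡ mark (not b)
not-marked true  {none} n _ = contradiction refl n
not-marked true  {out}  _ m = contradiction refl m
not-marked true  {inn}  _ _ = refl
not-marked false {none} n _ = contradiction refl n
not-marked false {out}  _ _ = refl
not-marked false {inn}  _ m = contradiction refl m

-- dArc true and dArc false are the arc relation and its converse, so that a
-- statement about marks b covers both senses at once.

dArc : Bool → ∀ {n} → Digraph n → Rel (Fin n) 0ℓ
dArc true  G u v = Arc G u v
dArc false G u v = Arc G v u

arc? : ∀ {n} (G : Digraph n) u v → Dec (Arc G u v)
arc? (G ▹ ls) zero    zero    = no λ ()
arc? (G ▹ ls) zero    (suc v) = lookup ls v ≟ˡ out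
arc? (G ▹ ls) (suc u) zero    = lookup ls u ≟ˡ inn
arc? (G ▹ ls) (suc u) (suc v) = arc? G u v

dArc? : ∀ b {n} (G : Digraph n) u v → Dec (dArc b G u v)
dArc? true  G u v = arc? G u v
dArc? false G u v = arc? G v u

arc-asym : ∀ {n} (G : Digraph n) {u v} → Arc G u v → ¬ Arc G v u
arc-asym (G ▹ ls) {zero}  {suc v} a a′ with () ← trans (sym a) a′
arc-asym (G ▹ ls) {suc u} {zero}  a a′ with () ← trans (sym a) a′
arc-asym (G ▹ ls) {suc u} {suc v} a a′ = arc-asym G a a′

dArc-asym : ∀ b {n} (G : Digraph n) {u v} → dArc b G u v → ¬ dArc b G v u
dArc-asym true  G a a′ = arc-asym G a a′
dArc-asym false G a a′ = arc-asym G a a′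

adjacent? : ∀ {n} (G : Digraph n) u v → Dec (Adjacent G u v)
adjacent? G u v = arc? G u v ⊎-dec arc? G v u

SameAdjacency : ∀ {n} → Digraph n → Digraph n → Set
SameAdjacency D E = ∀ u v → Adjacent D u v ⇔ Adjacent E u v

reorientation⇒sameAdjacency : ∀ {n} (D E : Digraph n) → IsReorientation D E → SameAdjacency D E
reorientation⇒sameAdjacency D E (S , r) u v = mk⇔ [ to , Sum.swap ∘ to ]′ [ from , Sum.swap ∘ from ]′
  where
  to : ∀ {u v} → Arc D u v → Adjacent E u v
  to {u} {v} a with S u v in eq
  ... | false = inj₁ (Equivalence.from (r u v) (inj₁ (a , eq)))
  ... | true  = inj₂ (Equivalence.from (r v u) (inj₂ (a , eq)))
  from : ∀ {u v} → Arc E u v → Adjacent D u v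
  from {u} {v} a = Sum.map proj₁ proj₁ (Equivalence.to (r u v) a)

-- The set to reverse is read off E: it contains an arc of D when E has the opposite arc. So the
-- reorientations of D are the digraphs with the same underlying graph, which is easier to check for
-- the elements constructed below.
sameAdjacency⇒reorientation : ∀ {n} (D E : Digraph n) → SameAdjacency D E → IsReorientation D E
sameAdjacency⇒reorientation D E adj = (λ u v → does (arc? E v u)) , λ u v → mk⇔ (to u v) (from u v)
  where
  to : ∀ u v → Arc E u v → (Arc D u v × does (arc? E v u) ≡ false) ⊎ (Arc D v u × does (arc? E u v) ≡ true)
  to u v a with Equivalence.from (adj u v) (inj₁ a)
  ... | inj₁ d with arc? E v u
  ...   | yes a′ = contradiction a′ (arc-asym E a)
  ...   | no _   = inj₁ (d , refl)
  to u v a | inj₂ d with arc? E u v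
  ...   | yes _ = inj₂ (d , refl)
  ...   | no ¬a = contradiction a ¬a
  from : ∀ u v → (Arc D u v × does (arc? E v u) ≡ false) ⊎ (Arc D v u × does (arc? E u v) ≡ true) → Arc E u v
  from u v (inj₁ (d , eq)) with Equivalence.to (adj u v) (inj₁ d)
  ... | inj₁ a = a
  ... | inj₂ a with arc? E v u
  ...   | no ¬a = contradiction a ¬a
  from u v (inj₂ (d , eq)) with arc? E u v
  ... | yes a = a

module _ {n} {D : Digraph n} where

  -- The proof stored in x is irrelevant, but adjacency is decidable, so a usable proof can be
  -- recomputed.
  adjacent⁺ : (x : AR D) → ∀ {u v} → Adjacent D u v → Adjacent (graph x) u v
  adjacent⁺ (mkAR E r _) {u} {v} a =
    recompute (adjacent? E u v) (Equivalence.to (reorientation⇒sameAdjacency D E r u v) a)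

  adjacent⁻ : (x : AR D) → ∀ {u v} → Adjacent (graph x) u v → Adjacent D u v
  adjacent⁻ (mkAR E r _) {u} {v} a =
    recompute (adjacent? D u v) (Equivalence.from (reorientation⇒sameAdjacency D E r u v) a)

  no-triangle : (x : AR D) → ∀ {u v w} → Arc (graph x) u v → Arc (graph x) v w → ¬ Arc (graph x) w u
  no-triangle (mkAR E _ acy) {u} a b c = ⊥-elim-irr (acy u (a ∷ b ∷ [ c ]⁺))

  dArc-total : ∀ b (x : AR D) {u v} → Adjacent D u v → ¬ dArc b (graph x) v u → dArc b (graph x) u v
  dArc-total true x adj ¬a with adjacent⁺ x adj
  ... | inj₁ a = a
  ... | inj₂ a = contradiction a ¬a
  dArc-total false x adj ¬a with adjacent⁺ x adj
  ... | inj₁ a = contradiction a ¬a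
  ... | inj₂ a = a

  dArc-trans : ∀ b (x : AR D) {u v w} → dArc b (graph x) u v → dArc b (graph x) v w →
               Adjacent D u w → dArc b (graph x) u w
  dArc-trans true  x a b adj = dArc-total true x adj (no-triangle x a b)
  dArc-trans false x a b adj = dArc-total false x adj (no-triangle x b a)

  AR-≡ : {x y : AR D} → graph x ≡ graph y → x ≡ y
  AR-≡ refl = refl

  ⊑-refl : {x : AR D} → x ⊑ x
  ⊑-refl r = r

digraph-ext : ∀ {n} {E F : Digraph n} → (∀ u v → Arc E u v → Arc F u v) →
              (∀ u v → Arc F u v → Arc E u v) → E ≡ F
digraph-ext {E = ∅}      {∅}      _  _    = refl
digraph-ext {E = E ▹ ls} {F ▹ ms} to from =
  cong₂ _▹_ (digraph-ext (λ u v → to (suc u) (suc v)) (λ u v → from (suc u) (suc v)))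
            (trans (sym (tabulate∘lookup ls)) (trans (tabulate-cong same) (tabulate∘lookup ms)))
  where
  same : ∀ v → lookup ls v ≡ lookup ms v
  same v with lookup ls v in eq | lookup ms v in eq′
  ... | none | none = refl
  ... | none | out  = trans (sym eq) (from zero (suc v) eq′)
  ... | none | inn  = trans (sym eq) (from (suc v) zero eq′)
  ... | out  | m    = trans (sym (to zero (suc v) eq)) eq′
  ... | inn  | m    = trans (sym (to (suc v) zero eq)) eq′

⊑-antisym : ∀ {n} {D : Digraph n} {x y : AR D} → x ⊑ y → y ⊑ x → x ≡ y
⊑-antisym {D = D} {x} {y} p q = AR-≡ (digraph-ext (λ _ _ → half x y p q) (λ _ _ → half y x q p))
  where
  half : ∀ (x y : AR D) → x ⊑ y → y ⊑ x → ∀ {u v} → Arc (graph x) u v → Arc (graph y) u v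
  half x y p q a with adjacent⁻ x (inj₁ a)
  ... | inj₁ d = dArc-total true y (inj₁ d) (λ a′ → arc-asym (graph x) a (proj₂ (q (d , a′))))
  ... | inj₂ d = proj₂ (p (d , a))

-- Le true and Le false are the order and its converse, which yields meets
-- from joins.

Le : Bool → ∀ {n} {D : Digraph n} → Rel (AR D) 0ℓ
Le true  x y = x ⊑ y
Le false x y = y ⊑ x

module _ {n} {D : Digraph n} where

  -- Along a chain each arc is turned at most once: an arc turned between y and z has not been
  -- turned between x and y.
  agree : ∀ s (x y z : AR D) → Le s x y → Le s y z → ∀ {u v} →
          Arc (graph y) u v → Arc (graph z) v u → Arc (graph x) u v
  agree s x y z p q a b with adjacent⁻ y (inj₁ a)
  agree true x y z p q a b | inj₁ d =
    dArc-total true x (inj₁ d) λ a′ → arc-asym (graph y) a (proj₂ (p (d , a′)))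
  agree true x y z p q a b | inj₂ d =
    contradiction b (arc-asym (graph z) (proj₂ (q (d , a))))
  agree false x y z p q a b | inj₁ d =
    contradiction (proj₂ (q (d , b))) (arc-asym (graph y) a)
  agree false x y z p q a b | inj₂ d = proj₂ (p (d , a))

  dArc-agree : ∀ c s (x y z : AR D) → Le s x y → Le s y z → ∀ {u v} →
               dArc c (graph y) u v → dArc c (graph z) v u → dArc c (graph x) u v
  dArc-agree true  s x y z p q a b = agree s x y z p q a b
  dArc-agree false s x y z p q a b = agree s x y z p q a b

-- Rails as families of up-sets

links : ∀ {n} → Digraph (suc n) → Vec Link n
links (_ ▹ ls) = ls

path-suc : ∀ {n} {E : Digraph n} {ms u v} → Path E u v → Path (E ▹ ms) (suc u) (suc v)
path-suc [ a ]⁺  = [ a ]⁺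
path-suc (a ∷ p) = a ∷ path-suc p

module _ {n} {E : Digraph n} {ms : Vec Link n}
         (fit : ∀ u v → lookup ms u ≡ inn → lookup ms v ≡ out → Arc E u v) where

  -- A passage u → n → v is bypassed by the arc u → v.

  bypass : ∀ {u v} → Path (E ▹ ms) (suc u) (suc v) → Path E u v
  bypass [ a ]⁺                              = [ a ]⁺
  bypass (_∷_ {y = suc _} a p)               = a ∷ bypass p
  bypass (_∷_ {y = zero} a ([_]⁺ {y = suc _} b))       = [ fit _ _ a b ]⁺
  bypass (_∷_ {y = zero} a (_∷_ {y = suc _} b p)) = fit _ _ a b ∷ bypass p

  -- A cycle through n leaves it to some u and returns from some w; the arc w → u given by `fit`
  -- closes a cycle that avoids n.
  fit⇒acyclic : Acyclic E → Acyclic (E ▹ ms)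
  fit⇒acyclic acy (suc v) p = acy v (bypass p)
  fit⇒acyclic acy zero ([_]⁺ {y = .zero} ())
  fit⇒acyclic acy zero (_∷_ {y = suc u} a p) = ends a p
    where
    ends : ∀ {u} → lookup ms u ≡ out → ¬ Path (E ▹ ms) (suc u) zero
    ends {u} a [ b ]⁺ with () ← trans (sym a) b
    ends {u} a (_∷_ {y = zero} b _) with () ← trans (sym a) b
    ends {u} a (_∷_ {y = suc _} b p) = acy u (b ∷ back p)
      where
      back : ∀ {w} → Path (E ▹ ms) (suc w) zero → Path E w u
      back [ c ]⁺                  = [ fit _ _ c a ]⁺
      back (_∷_ {y = suc _} c p)   = c ∷ back p
      -- The path is cut at its first visit to n.
      back (_∷_ {y = zero} c _)    = [ fit _ _ c a ]⁺

rest : ∀ {n} {D : Digraph n} {ls} → AR (D ▹ ls) → AR D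
rest {D = D} {ls} (mkAR (E ▹ ms) reo acy) =
  mkAR E (sameAdjacency⇒reorientation D E λ u v →
            reorientation⇒sameAdjacency (D ▹ ls) (E ▹ ms) reo (suc u) (suc v))
         (λ v p → acy (suc v) (path-suc p))

rail⇒rest : ∀ {n} {D : Digraph n} {ls} {E : AR D} (x : AR (D ▹ ls)) → Rail E x → rest x ≡ E
rail⇒rest (mkAR (E ▹ ms) _ _) refl = refl

rest-rail : ∀ {n} {D : Digraph n} {ls} (x : AR (D ▹ ls)) → Rail (rest x) x
rest-rail (mkAR (E ▹ ms) _ _) = refl

-- With o = `pole p`, `mark (signed s o)` is the mark that spreads as one moves up in `Le s`.
signed : Bool → Bool → Bool
signed true  o = o
signed false o = not o

choose : Link → Bool → Bool → Link
choose none _     _ = none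
choose _    true  q = mark q
choose _    false q = mark (not q)

choose-none : ∀ l {b q} → choose l b q ≡ none → l ≡ none
choose-none none _ = refl
choose-none out {true}  {q} eq = contradiction eq (mark≢none q)
choose-none out {false} {q} eq = contradiction eq (mark≢none (not q))
choose-none inn {true}  {q} eq = contradiction eq (mark≢none q)
choose-none inn {false} {q} eq = contradiction eq (mark≢none (not q))

choose-true : ∀ {l q} → l ≢ none → choose l true q ≡ mark q
choose-true {none} l≢ = contradiction refl l≢
choose-true {out}  _  = refl
choose-true {inn}  _  = refl

choose-false : ∀ {l q} → l ≢ none → choose l false q ≡ mark (not q)
choose-false {none} l≢ = contradiction refl l≢
choose-false {out}  _  = refl
choose-false {inn}  _  = refl

adjacent-zero⁺ : ∀ {n} {G : Digraph n} {ls v} → lookup ls v ≢ none → Adjacent (G ▹ ls) zero (suc v)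
adjacent-zero⁺ {ls = ls} {v} l≢ with lookup ls v
... | none = contradiction refl l≢
... | out  = inj₁ refl
... | inn  = inj₂ refl

adjacent-zero⁻ : ∀ {n} {G : Digraph n} {ls v} → Adjacent (G ▹ ls) zero (suc v) → lookup ls v ≢ none
adjacent-zero⁻ (inj₁ a) eq with () ← trans (sym eq) a
adjacent-zero⁻ (inj₂ a) eq with () ← trans (sym eq) a

-- For a source the links of n in D are `out`, for a sink they are `inn`; in both cases
-- `mark (pole p)` is the link of a reversed arc.
pole : {A B : Set} → A ⊎ B → Bool
pole (inj₁ _) = false
pole (inj₂ _) = true

module _ {n} {D : Digraph n} {ls : Vec Link n} where

  link : AR (D ▹ ls) → Fin n → Link
  link x = lookup (links (graph x))

  link≢none⁺ : ∀ x {v} → lookup ls v ≢ none → link x v ≢ none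
  link≢none⁺ x@(mkAR (E ▹ ms) _ _) {v} l≢ =
    adjacent-zero⁻ {G = E} {ms} {v} (adjacent⁺ x {zero} {suc v} (adjacent-zero⁺ {G = D} {ls} {v} l≢))

  link≢none⁻ : ∀ x {v} → link x v ≢ none → lookup ls v ≢ none
  link≢none⁻ x@(mkAR (E ▹ ms) _ _) {v} l≢ =
    adjacent-zero⁻ {G = D} {ls} {v} (adjacent⁻ x {zero} {suc v} (adjacent-zero⁺ {G = E} {ms} {v} l≢))

  marked⇒≢none : ∀ b x {v} → link x v ≡ mark b → lookup ls v ≢ none
  marked⇒≢none b x eq = link≢none⁻ x (λ eq′ → mark≢none b (trans (sym eq) eq′))

  marked-disjoint : ∀ b x {v} → link x v ≡ mark b → link x v ≢ mark (not b)
  marked-disjoint b x eq eq′ = mark≢not b (trans (sym eq) eq′)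

  AR-ext : {x y : AR (D ▹ ls)} → rest x ≡ rest y → (∀ v → link x v ≡ link y v) → x ≡ y
  AR-ext {mkAR (E ▹ ms) _ _} {mkAR (F ▹ ks) _ _} eq same = AR-≡ (cong₂ _▹_ (cong graph eq)
    (trans (sym (tabulate∘lookup ms)) (trans (tabulate-cong same) (tabulate∘lookup ks))))

  -- The underlying graph fixes which links are `none`, and every other link carries one of two
  -- marks, so the vertices marked b determine all links.
  AR-ext-marked : ∀ b {x y : AR (D ▹ ls)} → rest x ≡ rest y →
                  (∀ v → link x v ≡ mark b → link y v ≡ mark b) →
                  (∀ v → link y v ≡ mark b → link x v ≡ mark b) → x ≡ y
  AR-ext-marked b {x} {y} eq to from = AR-ext eq same
    where
    same : ∀ v → link x v ≡ link y v
    same v with lookup ls v ≟ˡ none | link x v ≟ˡ mark b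
    ... | no l≢ | yes m = trans m (sym (to v m))
    ... | no l≢ | no ¬m = trans (not-marked b (link≢none⁺ x l≢) ¬m)
                            (sym (not-marked b (link≢none⁺ y l≢) (¬m ∘ from v)))
    ... | yes l≡ | _ = trans (is-none x) (sym (is-none y))
      where
      is-none : ∀ z → link z v ≡ none
      is-none z with link z v ≟ˡ none
      ... | yes eq = eq
      ... | no neq = contradiction l≡ (link≢none⁻ z neq)

  module _ (simp : Simplicial (D ▹ ls) zero) where

    clique : ∀ {u v} → lookup ls u ≢ none → lookup ls v ≢ none → u ≢ v → Adjacent D u v
    clique {u} {v} lu lv u≢v = simp (suc u) (suc v) (adjacent-zero⁺ {G = D} {ls} {u} lu)
      (adjacent-zero⁺ {G = D} {ls} {v} lv) (u≢v ∘ suc-injectiveᶠ)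

    -- For b = `true` there are arcs u → n → v, and u and v are adjacent by simpliciality; an arc v
    -- → u would close a triangle. The other case is the converse.
    marked-closed : ∀ b x {u v} → link x u ≡ mark (not b) → link x v ≡ mark b →
                    dArc b (graph (rest x)) u v
    marked-closed b x {u} {v} mu mv =
      dArc-total b (rest x) (clique (marked⇒≢none (not b) x mu) (marked⇒≢none b x mv) u≢v) (no-back b x mu mv)
      where
      u≢v : u ≢ v
      u≢v refl = marked-disjoint b x mv mu
      no-back : ∀ b x → link x u ≡ mark (not b) → link x v ≡ mark b → ¬ dArc b (graph (rest x)) v u
      no-back true  x@(mkAR (E ▹ ms) _ _) mu mv a =
        no-triangle x {zero} {suc v} {suc u} mv a mu
      no-back false x@(mkAR (E ▹ ms) _ _) mu mv a =
        no-triangle x {zero} {suc u} {suc v} mu a mv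

    upward : ∀ b x {u v} → link x u ≡ mark b → lookup ls v ≢ none →
             dArc b (graph (rest x)) u v → link x v ≡ mark b
    upward b x {u} {v} mu lv a with link x v ≟ˡ mark b
    ... | yes mv = mv
    ... | no ¬mv = contradiction a (dArc-asym b (graph (rest x))
                     (marked-closed b x (not-marked b (link≢none⁺ x lv) ¬mv) mu))

    -- The converse of `upward`: each decidable up-set of neighbours is the set of vertices marked b
    -- in some element of the rail. Closedness is exactly the `fit` condition for acyclicity.
    rail-element : ∀ b (E : AR D) {U : Pred (Fin n) 0ℓ} → Decidable U →
                   (∀ {u v} → lookup ls u ≢ none → lookup ls v ≢ none →
                      U u → dArc b (graph E) u v → U v) →
                   ∃ λ (x : AR (D ▹ ls)) → rest x ≡ E × (∀ v → link x v ≡ mark b → U v) ×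
                     (∀ v → lookup ls v ≢ none → U v → link x v ≡ mark b)
    rail-element b E@(mkAR G r acy) {U} U? closed = mkAR (G ▹ ms) reo (fit⇒acyclic (fit b refl) acy) , refl , marked⁻ , marked⁺
      where
      l = λ v → choose (lookup ls v) (does (U? v)) b
      ms = tabulate l
      at : ∀ v → lookup ms v ≡ l v
      at = lookup∘tabulate l
      ms≢none : ∀ v → lookup ls v ≢ none → lookup ms v ≢ none
      ms≢none v l≢ eq = l≢ (choose-none (lookup ls v) {does (U? v)} {b} (trans (sym (at v)) eq))
      ls≢none : ∀ v → lookup ms v ≢ none → lookup ls v ≢ none
      ls≢none v m≢ eq = m≢ (trans (at v) (cong (λ l → choose l (does (U? v)) b) eq))
      marked⁺ : ∀ v → lookup ls v ≢ none → U v → lookup ms v ≡ mark b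
      marked⁺ v l≢ Uv with U? v in eq
      ... | yes _ = trans (at v) (trans (cong (λ d → choose (lookup ls v) (does d) b) eq) (choose-true l≢))
      ... | no ¬U = contradiction Uv ¬U
      marked⁻ : ∀ v → lookup ms v ≡ mark b → U v
      marked⁻ v m with U? v in eq
      ... | yes Uv = Uv
      ... | no _ = contradiction (trans (sym m) (trans (at v)
                     (trans (cong (λ d → choose (lookup ls v) (does d) b) eq) (choose-false l≢)))) (mark≢not b)
        where l≢ = ls≢none v λ eq → mark≢none b (trans (sym m) eq)
      fit′ : ∀ u v → lookup ms u ≡ mark (not b) → lookup ms v ≡ mark b → dArc b G u v
      fit′ u v mu mv = dArc-total b E (clique lu lv (λ { refl → ¬Uu (marked⁻ v mv) }))
                         (λ a → ¬Uu (closed lv lu (marked⁻ v mv) a))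
        where
        lu = ls≢none u λ eq → mark≢none (not b) (trans (sym mu) eq)
        lv = ls≢none v λ eq → mark≢none b (trans (sym mv) eq)
        ¬Uu : ¬ U u
        ¬Uu Uu = mark≢not b (trans (sym (marked⁺ u lu Uu)) mu)
      -- For b = `false` the marks `inn` and `out` exchange their roles, so `fit′` is applied to the
      -- swapped pair.
      fit : ∀ c → c ≡ b → ∀ u v → lookup ms u ≡ inn → lookup ms v ≡ out → Arc G u v
      fit true  refl u v mu mv = fit′ u v mu mv
      fit false refl u v mu mv = fit′ v u mv mu
      adj : ∀ u v → Adjacent D u v ⇔ Adjacent G u v
      adj u v = mk⇔ (adjacent⁺ E) (adjacent⁻ E)
      zero⁺ : ∀ v → Adjacent (D ▹ ls) zero (suc v) → Adjacent (G ▹ ms) zero (suc v)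
      zero⁺ v a = adjacent-zero⁺ {G = G} {ms} {v} (ms≢none v (adjacent-zero⁻ {G = D} {ls} {v} a))
      zero⁻ : ∀ v → Adjacent (G ▹ ms) zero (suc v) → Adjacent (D ▹ ls) zero (suc v)
      zero⁻ v a = adjacent-zero⁺ {G = D} {ls} {v} (ls≢none v (adjacent-zero⁻ {G = G} {ms} {v} a))
      reo : IsReorientation (D ▹ ls) (G ▹ ms)
      reo = sameAdjacency⇒reorientation (D ▹ ls) (G ▹ ms) λ where
        zero    zero    → mk⇔ [ (λ ()) , (λ ()) ]′ [ (λ ()) , (λ ()) ]′
        zero    (suc v) → mk⇔ (zero⁺ v) (zero⁻ v)
        (suc u) zero    → mk⇔ (Sum.swap ∘ zero⁺ u ∘ Sum.swap) (Sum.swap ∘ zero⁻ u ∘ Sum.swap)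
        (suc u) (suc v) → adj u v

  unreversed : (p : Source (D ▹ ls) zero ⊎ Sink (D ▹ ls) zero) →
               ∀ {v} → lookup ls v ≢ none → lookup ls v ≡ mark (not (pole p))
  unreversed p {v} l≢ with p | lookup ls v in eq
  ... | _        | none = contradiction refl l≢
  ... | inj₁ src | out  = refl
  ... | inj₁ src | inn  = contradiction eq (src (suc v))
  ... | inj₂ snk | out  = contradiction eq (snk (suc v))
  ... | inj₂ snk | inn  = refl

  module _ (p : Source (D ▹ ls) zero ⊎ Sink (D ▹ ls) zero) where

    ⊑⇒rest : {x y : AR (D ▹ ls)} → x ⊑ y → rest x ⊑ rest y
    ⊑⇒rest {mkAR (_ ▹ _) _ _} {mkAR (_ ▹ _) _ _} le {u} {v} r = le {suc u} {suc v} r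

    ⊑⇒marked : {x y : AR (D ▹ ls)} → x ⊑ y → ∀ v → link x v ≡ mark (pole p) → link y v ≡ mark (pole p)
    ⊑⇒marked {x@(mkAR (E ▹ ms) _ _)} {y@(mkAR (F ▹ ks) _ _)} le v m
      with pole p | unreversed p (marked⇒≢none (pole p) x m) | m
    ... | true  | eq | m′ = proj₂ (le {suc v} {zero} (eq , m′))
    ... | false | eq | m′ = proj₂ (le {zero} {suc v} (eq , m′))

    ⊑-intro : {x y : AR (D ▹ ls)} → rest x ⊑ rest y →
              (∀ v → link x v ≡ mark (pole p) → link y v ≡ mark (pole p)) → x ⊑ y
    ⊑-intro {mkAR (_ ▹ _) _ _} {mkAR (_ ▹ _) _ _} le to {zero}  {zero}  (() , _)
    ⊑-intro {mkAR (_ ▹ _) _ _} {mkAR (_ ▹ _) _ _} le to {suc u} {suc v} r = le r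
    ⊑-intro {mkAR (_ ▹ _) _ _} {mkAR (_ ▹ _) _ _} le to {zero} {suc v} (d , a)
      with pole p | unreversed p {v} (λ eq → adjacent-zero⁻ {G = D} {ls} {v} (inj₁ d) eq) | to v
    ... | true  | eq | _  with () ← trans (sym d) eq
    ... | false | _  | t  = d , t a
    ⊑-intro {mkAR (_ ▹ _) _ _} {mkAR (_ ▹ _) _ _} le to {suc v} {zero} (d , a)
      with pole p | unreversed p {v} (λ eq → adjacent-zero⁻ {G = D} {ls} {v} (inj₂ d) eq) | to v
    ... | true  | _  | t  = d , t a
    ... | false | eq | _  with () ← trans (sym d) eq

    marked-flip : (x y : AR (D ▹ ls)) → (∀ v → link x v ≡ mark (pole p) → link y v ≡ mark (pole p)) →
                  ∀ v → link y v ≡ mark (not (pole p)) → link x v ≡ mark (not (pole p))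
    marked-flip x y to v m = not-marked (pole p) (link≢none⁺ x (marked⇒≢none (not (pole p)) y m))
      (λ m′ → marked-disjoint (pole p) y (to v m′) m)

    marked-unflip : (x y : AR (D ▹ ls)) → (∀ v → link y v ≡ mark (not (pole p)) → link x v ≡ mark (not (pole p))) →
                    ∀ v → link x v ≡ mark (pole p) → link y v ≡ mark (pole p)
    marked-unflip x y to v m with link y v ≟ˡ mark (pole p)
    ... | yes m′ = m′
    ... | no ¬m′ = contradiction (to v (not-marked (pole p) (link≢none⁺ y (marked⇒≢none (pole p) x m)) ¬m′))
                                 (marked-disjoint (pole p) x m)

    Le⇒rest : ∀ s {x y : AR (D ▹ ls)} → Le s x y → Le s (rest x) (rest y)
    Le⇒rest true  {x} {y} = ⊑⇒rest {x} {y}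
    Le⇒rest false {x} {y} = ⊑⇒rest {y} {x}

    Le⇒marked : ∀ s {x y : AR (D ▹ ls)} → Le s x y →
                ∀ v → link x v ≡ mark (signed s (pole p)) → link y v ≡ mark (signed s (pole p))
    Le⇒marked true  {x} {y} le = ⊑⇒marked {x} {y} le
    Le⇒marked false {x} {y} le = marked-flip y x (⊑⇒marked {y} {x} le)

    -- With `Le⇒rest` and `Le⇒marked` this describes the order by the restriction and one set of
    -- neighbours, the coordinates in which joins are computed.
    Le-intro : ∀ s {x y : AR (D ▹ ls)} → Le s (rest x) (rest y) →
               (∀ v → link x v ≡ mark (signed s (pole p)) → link y v ≡ mark (signed s (pole p))) → Le s x y
    Le-intro true  {x} {y} le to = ⊑-intro {x} {y} le to
    Le-intro false {x} {y} le to = ⊑-intro {y} {x} le (marked-unflip y x to)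

-- Joins, meets and congruences

module _ {n} {D : Digraph n} where

  IsSup : Bool → AR D → AR D → AR D → Set
  IsSup s x y z = Le s x z × Le s y z × (∀ w → Le s x w → Le s y w → Le s z w)

  Le-refl : ∀ s {x : AR D} → Le s x x
  Le-refl true  r = r
  Le-refl false r = r

  Le-antisym : ∀ s {x y : AR D} → Le s x y → Le s y x → x ≡ y
  Le-antisym true  a b = ⊑-antisym a b
  Le-antisym false a b = ⊑-antisym b a

  Le-flip : ∀ s {x y : AR D} → Le s x y → Le (not s) y x
  Le-flip true  a = a
  Le-flip false a = a

  Le-unflip : ∀ s {x y : AR D} → Le (not s) x y → Le s y x
  Le-unflip true  a = a
  Le-unflip false a = a

  sup-absorbs : ∀ s (x y : AR D) → Le s y x → IsSup s x y x
  sup-absorbs s x y y≤x = Le-refl s , y≤x , λ _ x≤w _ → x≤w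

-- The restriction is the join of the restrictions. On top of it, the vertices marked in x or y have
-- to be marked, and their upward closure in that restriction is the least admissible set.
sup : ∀ {n} {D : Digraph n} → PeoConsistent D → ∀ s (x y : AR D) → ∃ λ z → IsSup s x y z
sup {D = ∅} _ s x y = x , Le-refl s , trivial s , λ _ x≤w _ → x≤w
  where
  trivial : ∀ s {x y : AR ∅} → Le s x y
  trivial true  {_} {_} {()}
  trivial false {_} {_} {()}
sup {D = D ▹ ls} (p , simp , peo) s x y
  with G , x≤G , y≤G , least ← sup peo s (rest x) (rest y) = z , x≤z , y≤z , z-least
  where
  q = signed s (pole p)
  Base U : Pred (Fin _) 0ℓ
  Base v = link x v ≡ mark q ⊎ link y v ≡ mark q
  -- A single arc from `Base` already yields the closure, because the arcs are transitive on the
  -- clique of neighbours.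
  U v = Base v ⊎ ∃ λ k → Base k × dArc q (graph G) k v
  base≢none : ∀ {v} → Base v → lookup ls v ≢ none
  base≢none = [ marked⇒≢none q x , marked⇒≢none q y ]′
  Base? : ∀ v → Dec (Base v)
  Base? v = (link x v ≟ˡ mark q) ⊎-dec (link y v ≟ˡ mark q)
  closed : ∀ {u v} → lookup ls u ≢ none → lookup ls v ≢ none → U u → dArc q (graph G) u v → U v
  closed _ _ (inj₁ bu) a = inj₂ (_ , bu , a)
  closed {v = v} _ lv (inj₂ (k , bk , a)) b with k ≟ᶠ v
  ... | yes refl = inj₁ bk
  ... | no k≢v   = inj₂ (k , bk , dArc-trans q G a b (clique simp (base≢none bk) lv k≢v))
  element = rail-element simp q G (λ v → Base? v ⊎-dec any? (λ k → Base? k ×-dec dArc? q (graph G) k v)) closed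
  z = proj₁ element
  rest-z : rest z ≡ G
  rest-z = proj₁ (proj₂ element)
  marked⁻ = proj₁ (proj₂ (proj₂ element))
  marked⁺ = proj₂ (proj₂ (proj₂ element))
  x≤z : Le s x z
  x≤z = Le-intro p s (subst (Le s (rest x)) (sym rest-z) x≤G)
          (λ v m → marked⁺ v (marked⇒≢none q x m) (inj₁ (inj₁ m)))
  y≤z : Le s y z
  y≤z = Le-intro p s (subst (Le s (rest y)) (sym rest-z) y≤G)
          (λ v m → marked⁺ v (marked⇒≢none q y m) (inj₁ (inj₂ m)))
  z-least : ∀ w → Le s x w → Le s y w → Le s z w
  z-least w x≤w y≤w = Le-intro p s (subst (λ G → Le s G (rest w)) (sym rest-z) G≤w) marked
    where
    G≤w : Le s G (rest w)
    G≤w = least (rest w) (Le⇒rest p s x≤w) (Le⇒rest p s y≤w)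
    -- If the arc k → v of G is reversed in w then it is an arc of t already.
    from : ∀ t → Le s t w → Le s (rest t) G → ∀ {k v} → link t k ≡ mark q → lookup ls v ≢ none →
           dArc q (graph G) k v → link w v ≡ mark q
    from t t≤w t≤G {k} {v} mk lv a with link w v ≟ˡ mark q
    ... | yes m = m
    ... | no ¬m = Le⇒marked p s t≤w v (upward simp q t mk lv
            (dArc-agree q s (rest t) G (rest w) t≤G G≤w a
              (marked-closed simp q w (not-marked q (link≢none⁺ w lv) ¬m) (Le⇒marked p s t≤w k mk))))
    marked : ∀ v → link z v ≡ mark q → link w v ≡ mark q
    marked v m with marked⁻ v m
    ... | inj₁ (inj₁ mx) = Le⇒marked p s x≤w v mx
    ... | inj₁ (inj₂ my) = Le⇒marked p s y≤w v my
    ... | inj₂ (k , inj₁ mx , a) = from x x≤w x≤G mx (marked⇒≢none q z m) a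
    ... | inj₂ (k , inj₂ my , a) = from y y≤w y≤G my (marked⇒≢none q z m) a

-- The least element of a rail with respect to Le s.

module _ {n} {D : Digraph n} {ls : Vec Link n} (p : Source (D ▹ ls) zero ⊎ Sink (D ▹ ls) zero) where

  rail-end : Bool → AR D → AR (D ▹ ls)
  rail-end true  = c p
  rail-end false = c̄ p

  rest-end : ∀ s E → rest (rail-end s E) ≡ E
  rest-end true  (mkAR _ _ _) = refl
  rest-end false (mkAR _ _ _) = refl

  private
    q : Bool → Bool
    q s = signed s (pole p)

  end-unmarked : ∀ s E {v} → link (rail-end s E) v ≢ mark (q s)
  end-unmarked true  E {v} m = mark≢not (pole p) (trans (sym m) (unreversed p (λ eq → mark≢none (pole p) (trans (sym m) eq))))
  end-unmarked false E {v} m = mark≢not (not (pole p)) (trans (sym m)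
    (trans (lookup-map v reverse ls) (trans (cong reverse (unreversed p l≢)) (reverse-mark (not (pole p))))))
    where
    l≢ : lookup ls v ≢ none
    l≢ eq = mark≢none (not (pole p)) (trans (sym m) (trans (lookup-map v reverse ls) (cong reverse eq)))

  -- The end carries none of the spreading marks, so only the restriction has to be compared. With
  -- `Le-restˡ` this makes `rail-end s` left adjoint to `rest` for the order `Le s`.
  ≤⇒end≤ : ∀ s {E} {x : AR (D ▹ ls)} → Le s E (rest x) → Le s (rail-end s E) x
  ≤⇒end≤ s {E} {x} le = Le-intro p s (subst (λ F → Le s F (rest x)) (sym (rest-end s E)) le)
    (λ v m → contradiction m (end-unmarked s E))

  end-mono : ∀ s E F → Le s E F → Le s (rail-end s E) (rail-end s F)
  end-mono s E F le = ≤⇒end≤ s (subst (Le s E) (sym (rest-end s F)) le)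

  end-≤ : ∀ s (x : AR (D ▹ ls)) → Le s (rail-end s (rest x)) x
  end-≤ s x = ≤⇒end≤ s (Le-refl s)

  -- Below an element without spreading marks there are none either, so the ends form a down-set of
  -- `Le s`.
  ≤-end⇒≡ : ∀ s {x E} → Le s x (rail-end s E) → x ≡ rail-end s (rest x)
  ≤-end⇒≡ s {x} {E} le = Le-antisym s
    (Le-intro p s (subst (Le s (rest x)) (sym (rest-end s (rest x))) (Le-refl s))
      (λ v m → contradiction (Le⇒marked p s le v m) (end-unmarked s E)))
    (end-≤ s x)

  Le-restˡ : ∀ s {E} {x : AR (D ▹ ls)} → Le s (rail-end s E) x → Le s E (rest x)
  Le-restˡ s {E} {x} le = subst (λ F → Le s F (rest x)) (rest-end s E) (Le⇒rest p s le)

-- For s = `false` this is the greatest element of `AR D`.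
bot : ∀ {n} (D : Digraph n) → PeoConsistent D → Bool → AR D
bot ∅        _             s = mkAR ∅ ((λ _ _ → false) , λ ()) (λ ())
bot (D ▹ ls) (p , _ , peo) s = rail-end p s (bot D peo s)

bot-≤ : ∀ {n} (D : Digraph n) (peo : PeoConsistent D) s (x : AR D) → Le s (bot D peo s) x
bot-≤ ∅        _             true  _ {()}
bot-≤ ∅        _             false _ {()}
bot-≤ (D ▹ ls) (p , _ , peo) s     x = ≤⇒end≤ p s (bot-≤ D peo s (rest x))

-- Covers in the quotient and the restricted congruence

module _ {n} {D : Digraph n} (peo : PeoConsistent D) {_≈_ : Rel (AR D) 0ℓ}
         (C : IsLatticeCongruence _≈_) where

  open IsLatticeCongruence C
  open IsEquivalence isEquivalence renaming (refl to ≈-refl; sym to ≈-sym; trans to ≈-trans)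

  sup-cong : ∀ s {x x′ y y′ j j′} → x ≈ x′ → y ≈ y′ → IsSup s x y j → IsSup s x′ y′ j′ → j ≈ j′
  sup-cong true  = ∨-cong
  sup-cong false = ∧-cong

  -- The meet of y with x is x and that of y with z is y; congruence of x and z makes the two meets
  -- congruent.
  convex : ∀ {x y z} → x ⊑ y → y ⊑ z → x ≈ z → x ≈ y
  convex {x} {y} {z} x⊑y y⊑z x≈z = sup-cong false {y} {y} {x} {z} ≈-refl x≈z
    ((λ {_} {_} → x⊑y) , (λ {_} {_} r → r) , λ _ _ w⊑x → w⊑x)
    ((λ {_} {_} r → r) , (λ {_} {_} → y⊑z) , λ _ w⊑y _ → w⊑y)

  cover : ∀ {x y} → x ⊑ y → ¬ x ≈ y → (∀ w → x ⊑ w → w ⊑ y → w ≈ x ⊎ w ≈ y) →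
          Quotient._⋖[]_ _≈_ x y
  cover {x} {y} x⊑y x≉y gap =
    (x≉y , x , y , ≈-refl , ≈-refl , x⊑y , λ { refl → x≉y ≈-refl }) , no-middle
    where
    no-middle : ¬ ∃ λ z → Quotient._<[]_ _≈_ x z × Quotient._<[]_ _≈_ z y
    no-middle (z , (x≉z , a , z′ , x≈a , z≈z′ , a⊑z′ , _) , (z≉y , z″ , b , z≈z″ , y≈b , z″⊑b , _))
      -- As x ≈ a ⊑ z′, joining z′ with x stays in the class of z; as z″ ⊑ b ≈ y, so does the meet
      -- of the result with y. The element m obtained lies between x and y.
      with j , J@(z′⊑j , x⊑j , _) ← sup peo true z′ x
      with m , M@(m⊑j , m⊑y , m-greatest) ← sup peo false j y
      = [ (λ m≈x → x≉z (≈-sym (≈-trans z≈m m≈x))) , (λ m≈y → z≉y (≈-trans z≈m m≈y)) ]′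
          (gap m (m-greatest x x⊑j x⊑y) m⊑y)
      where
      z′≈j : z′ ≈ j
      z′≈j = sup-cong true {z′} {z′} {a} {x} ≈-refl (≈-sym x≈a) (sup-absorbs true z′ a a⊑z′) J
      z″≈m : z″ ≈ m
      z″≈m = sup-cong false {z″} {j} {b} {y} (≈-trans (≈-sym z≈z″) (≈-trans z≈z′ z′≈j)) (≈-sym y≈b)
               (sup-absorbs false z″ b z″⊑b) M
      z≈m : z ≈ m
      z≈m = ≈-trans z≈z″ z″≈m

module _ {n} {D : Digraph n} {ls : Vec Link n} (p : Source (D ▹ ls) zero ⊎ Sink (D ▹ ls) zero)
         (simp : Simplicial (D ▹ ls) zero) (peo : PeoConsistent D)
         {_≈_ : Rel (AR (D ▹ ls)) 0ℓ} (C : IsLatticeCongruence _≈_) where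

  open IsLatticeCongruence C
  open IsEquivalence isEquivalence renaming (refl to ≈-refl; sym to ≈-sym; trans to ≈-trans; reflexive to ≈-reflexive)

  private
    peo-ls : PeoConsistent (D ▹ ls)
    peo-ls = p , simp , peo

    _≈*_ : Rel (AR D) 0ℓ
    _≈*_ = Restriction p _≈_

    supc : ∀ s {x x′ y y′ j j′} → x ≈ x′ → y ≈ y′ → IsSup s x y j → IsSup s x′ y′ j′ → j ≈ j′
    supc = sup-cong peo-ls C

  -- The restriction of x is the meet of x with c ⊤ and the join with c̄ ⊥.

  end-rest-cong : ∀ s {x y} → x ≈ y → rail-end p s (rest x) ≈ rail-end p s (rest y)
  end-rest-cong s x≈y = supc (not s) x≈y ≈-refl (isInf s _) (isInf s _)
    where
    -- The greatest element for `Le s`: its rail end lies above all ends of the kind s, and only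
    -- ends lie below it.
    top = bot D peo ∘ not
    isInf : ∀ s x → IsSup (not s) x (rail-end p s (top s)) (rail-end p s (rest x))
    isInf s x = Le-flip s (end-≤ p s x)
      , Le-flip s (end-mono p s _ _ (Le-unflip s (bot-≤ D peo (not s) (rest x))))
      , λ w x≤w top≤w → Le-flip s (subst (λ y → Le s y (rail-end p s (rest x)))
          (sym (≤-end⇒≡ p s (Le-unflip s top≤w)))
          (end-mono p s _ _ (Le⇒rest p s (Le-unflip s x≤w))))

  -- Either end restricts to E, so `end-rest-cong` passes from one end to the other: `c` and `c̄`
  -- induce the same restricted congruence.
  end-switch : ∀ s t {E F} → rail-end p s E ≈ rail-end p s F → rail-end p t E ≈ rail-end p t F
  end-switch s t {E} {F} eq = subst₂ (λ E F → rail-end p t E ≈ rail-end p t F)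
    (rest-end p s E) (rest-end p s F) (end-rest-cong t eq)

  -- `c` preserves joins as a left adjoint of `rest`. It preserves meets because every lower bound
  -- of c-ends is itself a c-end.
  restriction-congruence : IsLatticeCongruence _≈*_
  restriction-congruence = record
    { isEquivalence = record { refl = ≈-refl ; sym = ≈-sym ; trans = ≈-trans }
    ; ∨-cong = λ {x} {x′} {y} {y′} {j} {j′} x≈ y≈ J J′ →
        ∨-cong x≈ y≈ (c-join x y j J) (c-join x′ y′ j′ J′)
    ; ∧-cong = λ {x} {x′} {y} {y′} {m} {m′} x≈ y≈ M M′ →
        ∧-cong x≈ y≈ (c-meet x y m M) (c-meet x′ y′ m′ M′)
    } where
    c-join : ∀ E F G → IsJoin E F G → IsJoin (c p E) (c p F) (c p G)
    c-join E F G (E⊑G , F⊑G , least) =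
      (λ {u} {v} → end-mono p true E G E⊑G {u} {v}) , (λ {u} {v} → end-mono p true F G F⊑G {u} {v}) ,
      λ w E⊑w F⊑w {u} {v} → ≤⇒end≤ p true {G} {w} (least (rest w)
        (λ {u} {v} → Le-restˡ p true {E} {w} E⊑w {u} {v}) (λ {u} {v} → Le-restˡ p true {F} {w} F⊑w {u} {v})) {u} {v}
    c-meet : ∀ E F G → IsMeet E F G → IsMeet (c p E) (c p F) (c p G)
    c-meet E F G (G⊑E , G⊑F , greatest) =
      (λ {u} {v} → end-mono p true G E G⊑E {u} {v}) , (λ {u} {v} → end-mono p true G F G⊑F {u} {v}) ,
      λ w w⊑E w⊑F → λ {u} {v} → subst (λ x → Le true x (c p G)) (sym (≤-end⇒≡ p true {w} {E} w⊑E))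
        (λ {u} {v} → end-mono p true (rest w) G (greatest (rest w) (below {E} {w} w⊑E) (below {F} {w} w⊑F)) {u} {v}) {u} {v}
      where
      below : ∀ {E w} → w ⊑ c p E → rest w ⊑ E
      below {E} {w} le {u} {v} = subst (Le true (rest w)) (rest-end p true E)
        (λ {u} {v} → ⊑⇒rest p {w} {c p E} le {u} {v}) {u} {v}

  -- Moves x to the rail of E within its class: join with `c p E`, then meet with `c̄ p E`. Both
  -- steps stay in the class, since joining with `c p (rest x)` or meeting with `c̄ p (rest y)`
  -- would change nothing.
  transfer : ∀ x E → c p (rest x) ≈ c p E → ∃ λ x′ → rest x′ ≡ E × x ≈ x′
  transfer x E eq
    with y , Y@(x⊑y , cE⊑y , _) ← sup peo-ls true x (c p E)
    with x′ , X@(x′⊑y , x′⊑c̄E , greatest) ← sup peo-ls false y (c̄ p E)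
    = x′ , ⊑-antisym rest⊑ ⊑rest , ≈-trans x≈y y≈x′
    where
    x≈y : x ≈ y
    x≈y = supc true {x} {x} ≈-refl eq (sup-absorbs true x (c p (rest x)) (end-≤ p true x)) Y
    c̄eq : c̄ p (rest y) ≈ c̄ p E
    c̄eq = end-switch true false {rest y} {E} (≈-trans (≈-sym (end-rest-cong true x≈y)) eq)
    y≈x′ : y ≈ x′
    y≈x′ = supc false {y} {y} ≈-refl c̄eq (sup-absorbs false y (c̄ p (rest y)) (end-≤ p false y)) X
    rest⊑ : rest x′ ⊑ E
    rest⊑ {u} {v} = Le-restˡ p false {E} {x′} x′⊑c̄E {u} {v}
    ⊑rest : E ⊑ rest x′
    ⊑rest {u} {v} = Le-restˡ p true {E} {x′} (greatest (c p E) cE⊑y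
      λ {u} {v} → ≤⇒end≤ p true {E} {c̄ p E}
        (subst (Le true E) (sym (rest-end p false E)) (⊑-refl {x = E})) {u} {v}) {u} {v}

  private
    -- The infimum of z and the end over F is congruent to that of a and b, which is a, and hence to
    -- z. Lying below an end it is an end, so the class of z contains one.
    near-end : ∀ s a b {z F} → Le s a b → a ≈ z → b ≈ rail-end p s F → z ≈ rail-end p s (rest z)
    near-end s a b {z} {F} a≤b a≈z b≈F
      with m , M@(_ , m≤F , _) ← sup peo-ls (not s) z (rail-end p s F)
      = ≈-trans z≈m (≈-trans (≈-reflexive (≤-end⇒≡ p s (Le-unflip s m≤F))) (≈-sym (end-rest-cong s z≈m)))
      where
      z≈m : z ≈ m
      z≈m = ≈-trans (≈-sym a≈z) (supc (not s) a≈z b≈F (sup-absorbs (not s) a b (Le-flip s a≤b)) M)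

  -- A class strictly between those of the two rail ends meets the same end of
  -- its own rail, so that its restriction is strictly between as well.

  cover-end : ∀ s {E F} → Quotient._⋖[]_ _≈*_ E F →
              Quotient._⋖[]_ _≈_ (rail-end p s E) (rail-end p s F)
  cover-end s {E} {F} ((E≉F , x , y , E≈x , F≈y , x⊑y , x≢y) , gap) =
    ( (λ eq → E≉F (end-switch s true eq))
    , rail-end p s x , rail-end p s y , end-switch true s E≈x , end-switch true s F≈y
    , end-⊑ s x⊑y , λ eq → x≢y (trans (sym (rest-end p s x)) (trans (cong rest eq) (rest-end p s y))))
    , no-middle
    where
    end-⊑ : ∀ s {E F} → E ⊑ F → rail-end p s E ⊑ rail-end p s F
    end-⊑ true  {E} {F} le {u} {v} = end-mono p true E F le {u} {v}
    end-⊑ false {E} {F} le {u} {v} = end-mono p false F E le {u} {v}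
    no-middle : ¬ ∃ λ z → Quotient._<[]_ _≈_ (rail-end p s E) z × Quotient._<[]_ _≈_ z (rail-end p s F)
    no-middle (z , (E≉z , a , z′ , E≈a , z≈z′ , a⊑z′ , _) , (z≉F , z″ , b , z≈z″ , F≈b , z″⊑b , _)) =
      gap (rest z ,
        ( E≉rz , rest a , rest z′ , below E≈a , rest-cong z≈z′ , ⊑⇒rest p {a} {z′} a⊑z′
        , λ eq → E≉rz (≈-trans (below E≈a) (≈-trans (≈-reflexive (cong (c p) eq)) (≈-sym (rest-cong z≈z′))))) ,
        ( rz≉F , rest z″ , rest b , rest-cong z≈z″ , below F≈b , ⊑⇒rest p {z″} {b} z″⊑b
        , λ eq → rz≉F (≈-trans (rest-cong z≈z″) (≈-trans (≈-reflexive (cong (c p) eq)) (≈-sym (below F≈b))))))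
      where
      rest-cong : ∀ {x y} → x ≈ y → c p (rest x) ≈ c p (rest y)
      rest-cong = end-rest-cong true
      below : ∀ {E x} → rail-end p s E ≈ x → c p E ≈ c p (rest x)
      below {E} {x} eq = subst (λ G → c p G ≈ c p (rest x)) (rest-end p s E) (rest-cong eq)
      -- The c-ends are closed downwards, so the bound by F is used; the c̄-ends are closed upwards,
      -- so the bound by E is.
      close : ∀ s → rail-end p s E ≈ a → rail-end p s F ≈ b → z ≈ rail-end p s (rest z)
      close true  _   F≈b = near-end true z″ b {z} {F} z″⊑b (≈-sym z≈z″) (≈-sym F≈b)
      close false E≈a _   = near-end false z′ a {z} {E} a⊑z′ (≈-sym z≈z′) (≈-sym E≈a)
      z≈end : z ≈ rail-end p s (rest z)
      z≈end = close s E≈a F≈b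
      E≉rz : ¬ E ≈* rest z
      E≉rz eq = E≉z (≈-trans (end-switch true s eq) (≈-sym z≈end))
      rz≉F : ¬ rest z ≈* F
      rz≉F eq = z≉F (≈-trans z≈end (end-switch true s eq))

-- The encoding by permutations

module _ {R R′ : Rel ℕ 0ℓ} where

  allPairs-insert : ∀ {N} xs {ys} → (∀ {a b} → a ∈ˡ xs ++ ys → b ∈ˡ xs ++ ys → R a b → R′ a b) →
                    (∀ {a} → a ∈ˡ xs → R′ a N) → (∀ {b} → b ∈ˡ ys → R′ N b) →
                    AllPairs R (xs ++ ys) → AllPairs R′ (xs ++ N ∷ ys)
  allPairs-insert [] {ys} f g h ps = All.tabulate h ∷ map-∈ ys f ps
    where
    map-∈ : ∀ ys → (∀ {a b} → a ∈ˡ ys → b ∈ˡ ys → R a b → R′ a b) → AllPairs R ys → AllPairs R′ ys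
    map-∈ []       f []       = []
    map-∈ (y ∷ ys) f (p ∷ ps) =
      All.tabulate (λ b∈ → f (here refl) (there b∈) (All.lookup p b∈)) ∷
      map-∈ ys (λ a∈ b∈ → f (there a∈) (there b∈)) ps
  allPairs-insert (x ∷ xs) {ys} f g h (p ∷ ps) =
    All-++⁺ (All.tabulate λ b∈ → f′ (∈-++⁺ˡ b∈))
            (g (here refl) ∷ All.tabulate λ b∈ → f′ (∈-++⁺ʳ xs b∈)) ∷
    allPairs-insert xs (λ a∈ b∈ → f (there a∈) (there b∈)) (g ∘ there) h ps
    where
    f′ : ∀ {b} → b ∈ˡ xs ++ ys → R′ x b
    f′ b∈ = f (here refl) (there b∈) (All.lookup p b∈)

allPairs-lookup : ∀ {R : Rel ℕ 0ℓ} {xs ys a b} → AllPairs R (xs ++ ys) → a ∈ˡ xs → b ∈ˡ ys → R a b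
allPairs-lookup {xs = x ∷ xs} (p ∷ _)  (here refl) b∈ = All.lookup p (∈-++⁺ʳ xs b∈)
allPairs-lookup {xs = x ∷ xs} (_ ∷ ps) (there a∈)  b∈ = allPairs-lookup ps a∈ b∈

unique⇒∉ : ∀ {a} xs {ys : Word} → AllPairs _≢_ (xs ++ a ∷ ys) → a ∉ˡ xs × a ∉ˡ ys
unique⇒∉ xs {ys} uniq = (λ a∈ → allPairs-lookup {xs = xs} uniq a∈ (here refl) refl) , after xs uniq
  where
  after : ∀ {a} xs {ys} → AllPairs _≢_ (xs ++ a ∷ ys) → a ∉ˡ ys
  after []       (p ∷ _)  a∈ = All.lookup p a∈ refl
  after (_ ∷ xs) (_ ∷ ps) a∈ = after xs ps a∈

suffix : ∀ (xs xs′ : Word) {ys ys′} → xs ++ ys ≡ xs′ ++ ys′ → length xs ≤ length xs′ →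
         ∃ λ zs → ys ≡ zs ++ ys′
suffix []       xs′        eq _        = xs′ , eq
suffix (x ∷ xs) (x′ ∷ xs′) eq (s≤s le) = suffix xs xs′ (proj₂ (∷-injective eq)) le

first : ∀ {P : Pred ℕ 0ℓ} → Decidable P → ∀ {a} {π : Word} → a ∈ˡ π → P a →
        ∃ λ xs → ∃₂ λ b ys → π ≡ xs ++ b ∷ ys × P b × (∀ {a} → a ∈ˡ xs → ¬ P a)
first P? {π = b ∷ π} a∈ Pa with P? b
... | yes Pb = [] , b , π , refl , Pb , λ ()
first P? {π = b ∷ π} (here refl) Pa | no ¬Pb = contradiction Pa ¬Pb
first P? {π = b ∷ π} (there a∈)  Pa | no ¬Pb with xs , c , ys , refl , Pc , ¬P ← first P? a∈ Pa =
  b ∷ xs , c , ys , refl , Pc , λ { (here refl) → ¬Pb ; (there d∈) → ¬P d∈ }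

++-split : ∀ (xs xs′ : Word) {ys ys′} → xs ++ ys ≡ xs′ ++ ys′ → length xs ≡ length xs′ →
           xs ≡ xs′ × ys ≡ ys′
++-split []       []         eq _ = refl , eq
++-split (x ∷ xs) (x′ ∷ xs′) eq l with refl , eq′ ← ∷-injective eq
  with refl , refl ← ++-split xs xs′ eq′ (suc-injective l) = refl , refl

label-injective : ∀ {n} {u v : Fin n} → label u ≡ label v → u ≡ v
label-injective {n} {u} {v} eq = toℕ-injective (∸-cancelˡ-≡ (<⇒≤ (toℕ<n u)) (<⇒≤ (toℕ<n v)) eq)

label< : ∀ {n} (v : Fin n) → label v < suc n
label< {n} v = s≤s (m∸n≤m n (toℕ v))

encodes-split : ∀ {n} {E : Digraph n} {ms π} → Encodes (E ▹ ms) π →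
                ∃₂ λ xs ys → π ≡ xs ++ suc n ∷ ys × Encodes E (xs ++ ys)
encodes-split (sink {E = E} {π = π} _ e)           = π , [] , refl , subst (Encodes E) (sym (++-identityʳ π)) e
encodes-split (source {π = π} _ _ e)               = [] , π , refl , e
encodes-split (between xs v ys _ _ _ _ e)          = xs , label v ∷ ys , refl , e

encodes-letters : ∀ {n} {E : Digraph n} {π} → Encodes E π → All (_< suc n) π
encodes-letters {E = ∅}      empty = []
encodes-letters {suc n} {E ▹ ms} e with xs , ys , refl , e′ ← encodes-split e =
  All.tabulate λ a∈ → letter (∈-++⁻ xs a∈)
  where
  old : ∀ {a} → a ∈ˡ xs ++ ys → a < suc (suc n)
  old a∈ = m<n⇒m<1+n (All.lookup (encodes-letters e′) a∈)
  letter : ∀ {a} → a ∈ˡ xs ⊎ a ∈ˡ suc n ∷ ys → a < suc (suc n)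
  letter (inj₁ a∈)          = old (∈-++⁺ˡ a∈)
  letter (inj₂ (here refl)) = ≤-refl
  letter (inj₂ (there a∈))  = old (∈-++⁺ʳ xs a∈)

encodes-unique : ∀ {n} {E : Digraph n} {π} → Encodes E π → AllPairs _≢_ π
encodes-unique {E = ∅}          empty = []
encodes-unique {suc n} {E ▹ ms} e with xs , ys , refl , e′ ← encodes-split e =
  allPairs-insert {R = _≢_} xs (λ _ _ a≢b → a≢b)
    (λ { a∈ refl → N∉ (∈-++⁺ˡ a∈) }) (λ { b∈ refl → N∉ (∈-++⁺ʳ xs b∈) }) (encodes-unique e′)
  where N∉ = all<⇒∉ (encodes-letters e′)

encodes-label : ∀ {n} {E : Digraph n} {π} → Encodes E π → ∀ (v : Fin n) → label v ∈ˡ π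
encodes-label {suc n} {E ▹ ms} e v with xs , ys , refl , e′ ← encodes-split e with v
... | zero   = ∈-insert xs
... | suc v′ = [ ∈-++⁺ˡ , ∈-++⁺ʳ xs ∘ there ]′ (∈-++⁻ xs (encodes-label e′ v′))

encodes-permutation : ∀ {n} {E : Digraph n} {π} → Encodes E π → S n π
encodes-permutation {E = ∅}          empty = ↭-refl
encodes-permutation {suc n} {E ▹ ms} e with xs , ys , refl , e′ ← encodes-split e =
  ↭-trans (insert-↭ xs) (↭-trans (prep (suc n) (encodes-permutation e′))
    (subst (suc n ∷ idₙ n ↭_) (applyUpTo-∷ʳ suc n) (∷↭∷ʳ (suc n) (idₙ n))))
  where
  insert-↭ : ∀ {N} xs {ys : Word} → xs ++ N ∷ ys ↭ N ∷ xs ++ ys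
  insert-↭ []           = ↭-refl
  insert-↭ {N} (x ∷ xs) = ↭-trans (prep x (insert-↭ xs)) (swap x N ↭-refl)

encodes-functional : ∀ {n} {E : Digraph n} {π ρ} → Encodes E π → Encodes E ρ → π ≡ ρ
encodes-functional empty empty = refl
encodes-functional (sink _ e) (sink _ f) = cong (_++ [ _ ]) (encodes-functional e f)
encodes-functional (sink s _) (source ¬s _ _) = contradiction s ¬s
encodes-functional (sink s _) (between _ _ _ ¬s _ _ _ _) = contradiction s ¬s
encodes-functional (source ¬s _ _) (sink s _) = contradiction s ¬s
encodes-functional (source _ _ e) (source _ _ f) = cong (_ ∷_) (encodes-functional e f)
encodes-functional (source _ s _) (between _ _ _ _ ¬s _ _ _) = contradiction s ¬s
encodes-functional (between _ _ _ ¬s _ _ _ _) (sink s _) = contradiction s ¬s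
encodes-functional (between _ _ _ _ ¬s _ _ _) (source _ s _) = contradiction s ¬s
encodes-functional (between xs v ys _ _ tr _ e) (between xs′ v′ ys′ _ _ _ unique f)
  with refl ← unique (suc v) tr
  with v∉xs , v∉ys ← unique⇒∉ xs (encodes-unique e)
  with refl , refl ← unique-split {xs = xs} v∉xs v∉ys (encodes-functional e f) = refl

Sorted : ∀ {n} → Digraph n → Word → Set
Sorted G = AllPairs (λ a b → ∀ u v → label u ≡ a → label v ≡ b → ¬ Arc G v u)

module _ {n} {D : Digraph n} {ls : Vec Link n} where

  -- Inserting n between `xs` and `ys` respects its arcs. This common form replaces the three cases
  -- of `Encodes`.
  Fits : AR (D ▹ ls) → Word → Word → Set
  Fits x xs ys = (∀ v → label v ∈ˡ xs → link x v ≢ out) × (∀ v → label v ∈ˡ ys → link x v ≢ inn)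

  -- Sortedness of the shorter word enters as a hypothesis, because `sorted` is proved by recursion
  -- through this lemma.
  fits : Simplicial (D ▹ ls) zero → (x : AR (D ▹ ls)) →
         (∀ {σ} → Encodes (graph (rest x)) σ → Sorted (graph (rest x)) σ) →
         ∀ {π} → Encodes (graph x) π →
         ∃₂ λ xs ys → π ≡ xs ++ suc n ∷ ys × Encodes (graph (rest x)) (xs ++ ys) × Fits x xs ys
  fits simp (mkAR (E ▹ ms) _ _) _ (sink {π = π} snk e) =
    π , [] , refl , subst (Encodes E) (sym (++-identityʳ π)) e , (λ v _ → snk (suc v)) , λ _ ()
  fits simp (mkAR (E ▹ ms) _ _) _ (source {π = π} _ src e) =
    [] , π , refl , e , (λ _ ()) , λ v _ → src (suc v)
  fits simp x@(mkAR (E ▹ ms) _ _) sort (between xs v ys _ _ (out-v , no-inner) _ e) =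
    xs , label v ∷ ys , refl , e , not-out , not-inn
    where
    sorted = sort e
    v∉xs = proj₁ (unique⇒∉ xs (encodes-unique e))
    -- An out-neighbour w in front of v is adjacent to v. The arc w → v would remove n → v from the
    -- transitive reduction, and v → w contradicts the order of the word.
    not-out : ∀ w → label w ∈ˡ xs → link x w ≢ out
    not-out w w∈ out-w = allPairs-lookup {xs = xs} sorted w∈ (here refl) w v refl refl
      (dArc-total true (rest x) (clique simp (marked⇒≢none true x out-v) (marked⇒≢none true x out-w) v≢w)
        λ a → no-inner (suc w , out-w , [ a ]⁺))
      where
      v≢w : v ≢ w
      v≢w refl = v∉xs w∈
    not-inn : ∀ w → label w ∈ˡ label v ∷ ys → link x w ≢ inn
    not-inn w (here eq) inn-w with refl ← label-injective {u = w} {v} eq with () ← trans (sym out-v) inn-w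
    not-inn w (there w∈) inn-w = allPairs-lookup {xs = xs ++ [ label v ]}
      (subst (Sorted E) (sym (++-assoc xs [ label v ] ys)) sorted) (∈-++⁺ʳ xs (here refl)) w∈ v w refl refl
      (marked-closed simp true x inn-w out-v)

sorted : ∀ {n} {D : Digraph n} → PeoConsistent D → (x : AR D) → ∀ {π} →
         Encodes (graph x) π → Sorted (graph x) π
sorted {D = ∅}      _ (mkAR ∅ _ _) empty = []
sorted {suc n} {D = D ▹ ls} (_ , simp , peo) x@(mkAR (E ▹ ms) _ _) e
  with xs , ys , refl , e′ , not-out , not-inn ← fits simp x (sorted peo (rest x)) e =
  allPairs-insert xs old
    (λ { a∈ zero    v       eq _  a → N∉ (subst (_∈ˡ xs ++ ys) (sym eq) (∈-++⁺ˡ a∈))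
       ; a∈ (suc u) zero    refl _  a → not-out u a∈ a
       ; a∈ (suc u) (suc v) _  eq a → <⇒≢ (label< v) eq })
    (λ { b∈ u       zero    _  eq a → N∉ (subst (_∈ˡ xs ++ ys) (sym eq) (∈-++⁺ʳ xs b∈))
       ; b∈ zero    (suc v) _  refl a → not-inn v b∈ a
       ; b∈ (suc u) (suc v) eq _  a → <⇒≢ (label< u) eq })
    (sorted peo (rest x) e′)
  where
  N∉ : suc n ∉ˡ xs ++ ys
  N∉ = all<⇒∉ (encodes-letters e′)
  old : ∀ {a b} → a ∈ˡ xs ++ ys → b ∈ˡ xs ++ ys →
        (∀ u v → label u ≡ a → label v ≡ b → ¬ Arc E v u) →
        ∀ u v → label u ≡ a → label v ≡ b → ¬ Arc (E ▹ ms) v u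
  old a∈ b∈ f zero    v       refl _    = contradiction a∈ N∉
  old a∈ b∈ f (suc u) zero    _    refl = contradiction b∈ N∉
  old a∈ b∈ f (suc u) (suc v) eq   eq′  = f u v eq eq′

module _ {n} {D : Digraph n} {ls : Vec Link n} (simp : Simplicial (D ▹ ls) zero) (peo : PeoConsistent D) where

  encodes-fits : (x : AR (D ▹ ls)) → ∀ {π} → Encodes (graph x) π →
                 ∃₂ λ xs ys → π ≡ xs ++ suc n ∷ ys × Encodes (graph (rest x)) (xs ++ ys) × Fits x xs ys
  encodes-fits x = fits simp x (sorted peo (rest x))

  fits-unique : (x y : AR (D ▹ ls)) → rest x ≡ rest y → ∀ xs ys →
                Encodes (graph (rest x)) (xs ++ ys) → Fits x xs ys → Fits y xs ys → x ≡ y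
  fits-unique x y eq xs ys e fx fy =
    AR-ext-marked true eq (half x y fx fy) (half y x fy fx)
    where
    half : ∀ (x y : AR (D ▹ ls)) → Fits x xs ys → Fits y xs ys → ∀ v → link x v ≡ out → link y v ≡ out
    half x y (not-out , _) (_ , not-inn) v m with ∈-++⁻ xs (encodes-label e v)
    ... | inj₁ v∈ = contradiction m (not-out v v∈)
    ... | inj₂ v∈ = not-marked false (link≢none⁺ y (marked⇒≢none true x m)) (not-inn v v∈)

  encodes-fits-at : (x : AR (D ▹ ls)) → ∀ {i σ} → i ≤ length σ → Encodes (graph (rest x)) σ →
                    Encodes (graph x) (ins (suc n) i σ) →
                    ∃₂ λ xs ys → σ ≡ xs ++ ys × i ≡ length xs × Fits x xs ys
  encodes-fits-at x i≤m e f with xs , ys , eq , e′ , fit ← encodes-fits x f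
    with eq₁ , eq₂ ← ins-split (all<⇒∉ (encodes-letters e)) xs i≤m eq = xs , ys , eq₁ , eq₂ , fit

  out-antitone : (x y : AR (D ▹ ls)) → rest x ≡ rest y → ∀ {i j σ} → i ≤ j → j ≤ length σ →
                 Encodes (graph (rest x)) σ → Encodes (graph x) (ins (suc n) i σ) →
                 Encodes (graph y) (ins (suc n) j σ) → ∀ v → link y v ≡ out → link x v ≡ out
  out-antitone x y eq i≤j j≤m e fx fy v m
    with xs , ys , refl , refl , _ , not-inn ← encodes-fits-at x (≤-trans i≤j j≤m) e fx
    with xs′ , ys′ , eq′ , refl , not-out , _ ← encodes-fits-at y j≤m (subst (λ E → Encodes (graph E) _) eq e) fy
    with zs , refl ← suffix xs xs′ eq′ i≤j
    with ∈-++⁻ xs′ (subst (label v ∈ˡ_) eq′ (encodes-label e v))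
  ... | inj₁ v∈ = contradiction m (not-out v v∈)
  ... | inj₂ v∈ = not-marked false (link≢none⁺ x (marked⇒≢none true y m)) (not-inn v (∈-++⁺ʳ zs v∈))

  -- Neighbours in front of the slot must be linked by `inn`, those behind by `out`, and sortedness
  -- makes this assignment closed. The element found may be encoded at another slot, as slots with
  -- no neighbour between them share it; hence only uniqueness is claimed.
  slot-element : (E : AR D) → ∀ {i σ} → i ≤ length σ → Encodes (graph E) σ →
                 ∃ λ (x : AR (D ▹ ls)) → rest x ≡ E ×
                   (∀ y → rest y ≡ E → Encodes (graph y) (ins (suc n) i σ) → y ≡ x)
  slot-element E {i} {σ} i≤m e with xs , ys , refl , refl ← split-at σ i≤m
    with x , refl , marked⁻ , marked⁺ ← rail-element simp false E (λ v → _∈?_ _≟_ (label v) xs)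
           (λ {u} {v} _ _ u∈ a → [ id , (λ v∈ → contradiction a
             (allPairs-lookup {xs = xs} (sorted peo E e) u∈ v∈ u v refl refl)) ]′ (∈-++⁻ xs (encodes-label e v)))
    = x , refl , unique
    where
    fit : Fits x xs ys
    fit = (λ v v∈ m → marked-disjoint true x m (marked⁺ v (marked⇒≢none true x m) v∈))
        , λ v v∈ m → allPairs-lookup {xs = xs} (encodes-unique e) (marked⁻ v m) v∈ refl
    unique : ∀ y → rest y ≡ rest x → Encodes (graph y) (ins (suc n) (length xs) (xs ++ ys)) → y ≡ x
    unique y eq f with e′ ← subst (λ E → Encodes (graph E) (xs ++ ys)) (sym eq) e
      with xs′ , ys′ , eq₁ , eq₂ , fy ← encodes-fits-at y i≤m e′ f
      with refl , refl ← ++-split xs xs′ eq₁ eq₂ = fits-unique y x eq xs ys e′ fy fit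

encodes-injective : ∀ {n} {D : Digraph n} → PeoConsistent D → (x y : AR D) → ∀ {π} →
                    Encodes (graph x) π → Encodes (graph y) π → x ≡ y
encodes-injective {D = ∅} _ (mkAR ∅ _ _) (mkAR ∅ _ _) _ _ = refl
encodes-injective {suc n} {D = D ▹ ls} (_ , simp , peo) x y e f
  with xs , ys , refl , e′ , fx ← encodes-fits simp peo x e
  with xs′ , ys′ , eq , f′ , fy ← encodes-fits simp peo y f
  with N∉ ← all<⇒∉ (encodes-letters e′)
  with refl , refl ← unique-split {xs = xs} (N∉ ∘ ∈-++⁺ˡ) (N∉ ∘ ∈-++⁺ʳ xs) eq
  = fits-unique simp peo x y (encodes-injective peo (rest x) (rest y) e′ f′) xs ys e′ fx fy

-- If n is neither source nor sink, v is its first out-neighbour in the shorter word. By the clique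
-- property and sortedness v has arcs to all other out-neighbours, which leaves v as the only one in
-- the transitive reduction.
encodes-exists : ∀ {n} {D : Digraph n} → PeoConsistent D → (x : AR D) → ∃ (Encodes (graph x))
encodes-exists {D = ∅} _ (mkAR ∅ _ _) = [] , empty
encodes-exists {D = D ▹ ls} (_ , simp , peo) x@(mkAR (E ▹ ms) reo acy)
  with σ , e ← encodes-exists peo (rest x)
  with any? (λ v → link x v ≟ˡ out)
... | no ¬out = _ , sink (λ { zero () ; (suc v) m → ¬out (v , m) }) e
... | yes (w , out-w) with any? (λ v → link x v ≟ˡ inn)
...   | no ¬inn = _ , source (λ snk → snk (suc w) out-w) (λ { zero () ; (suc v) m → ¬inn (v , m) }) e
...   | yes (z , inn-z)
        with xs , _ , ys , refl , (v , refl , out-v) , ¬P ←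
               first (λ a → any? λ v → (label v ≟ a) ×-dec (link x v ≟ˡ out)) (encodes-label e w) (w , refl , out-w)
        = _ , between xs v ys (λ snk → snk (suc w) out-w) (λ src → src (suc z) inn-z)
                (out-v , no-inner) unique e
  where
  after : ∀ w → link x w ≡ out → v ≢ w → Arc E v w
  after w out-w v≢w = dArc-total true (rest x)
    (clique simp (marked⇒≢none true x out-v) (marked⇒≢none true x out-w) v≢w)
    (allPairs-lookup {xs = xs ++ [ label v ]}
      (subst (Sorted E) (sym (++-assoc xs [ label v ] ys)) (sorted peo (rest x) e))
      (∈-++⁺ʳ xs (here refl)) w∈ v w refl refl)
    where
    w∈ : label w ∈ˡ ys
    w∈ with ∈-++⁻ xs (encodes-label e w)
    ... | inj₁ w∈xs       = contradiction (w , refl , out-w) (¬P w∈xs)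
    ... | inj₂ (here eq)  = contradiction (sym (label-injective {u = w} {v} eq)) v≢w
    ... | inj₂ (there w∈) = w∈
  no-inner : ¬ ∃ λ w → Arc (E ▹ ms) zero w × Path (E ▹ ms) w (suc v)
  no-inner (suc w , out-w , path) with v ≟ᶠ w
  ... | yes refl = ⊥-elim-irr (acy (suc v) path)
  ... | no v≢w   = ⊥-elim-irr (acy (suc v) (after w out-w v≢w ∷ path))
  unique : ∀ w → TransitiveReduction (E ▹ ms) zero w → w ≡ suc v
  unique (suc w) (out-w , no-inner′) with v ≟ᶠ w
  ... | yes refl = refl
  ... | no v≢w   = contradiction (suc v , out-v , [ after w out-w v≢w ]⁺) no-inner′

-- The generated representatives

module _ {n} {D : Digraph n} (peo : PeoConsistent D) {_≈_ : Rel (AR D) 0ℓ}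
         (C : IsLatticeCongruence _≈_) where

  open IsEquivalence (IsLatticeCongruence.isEquivalence C) renaming (refl to ≈-refl; sym to ≈-sym; trans to ≈-trans)

  convex-Le : ∀ s {x y z} → Le s x y → Le s y z → x ≈ z → x ≈ y
  convex-Le true  {x} {y} {z} x⊑y y⊑z x≈z = convex peo C {x} {y} {z} x⊑y y⊑z x≈z
  convex-Le false {x} {y} {z} y⊑x z⊑y x≈z =
    ≈-trans x≈z (convex peo C {z} {y} {x} z⊑y y⊑x (≈-sym x≈z))

  cover-Le : ∀ s {x y} → Le s x y → ¬ x ≈ y → (∀ w → Le s x w → Le s w y → w ≈ x ⊎ w ≈ y) →
             Quotient.CoverGraph _≈_ x y
  cover-Le true  {x} {y} le x≉y gap = inj₁ (cover peo C {x} {y} le x≉y gap)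
  cover-Le false {x} {y} le x≉y gap =
    inj₂ (cover peo C {y} {x} le (x≉y ∘ ≈-sym) λ w y⊑w w⊑x → Sum.swap (gap w w⊑x y⊑w))

signed-self : ∀ b → signed b b ≡ true
signed-self true  = refl
signed-self false = refl

signed-not : ∀ b → signed (not b) b ≡ false
signed-not true  = refl
signed-not false = refl

module _ {n} {D : Digraph n} {ls : Vec Link n} where

  encodes-sink : (x : AR (D ▹ ls)) → (∀ v → link x v ≢ out) → ∀ {σ} →
                 Encodes (graph (rest x)) σ → Encodes (graph x) (σ ++ [ suc n ])
  encodes-sink (mkAR (_ ▹ _) _ _) ¬out e = sink (λ { zero () ; (suc v) → ¬out v }) e

  -- An isolated n counts as a sink and is appended; the neighbour v excludes this.
  encodes-source : (x : AR (D ▹ ls)) → (∀ v → link x v ≢ inn) → ∀ {v σ} → lookup ls v ≢ none →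
                   Encodes (graph (rest x)) σ → Encodes (graph x) (suc n ∷ σ)
  encodes-source x@(mkAR (_ ▹ _) _ _) ¬inn {v} l≢ e =
    source (λ snk → snk (suc v) (not-marked false (link≢none⁺ x l≢) (¬inn v)))
           (λ { zero () ; (suc v) → ¬inn v }) e

-- Quantifying over all encoded elements lifts the cover relation to words without choosing
-- preimages; injectivity of the encoding pins them down.
Covers : ∀ {n} {D : Digraph n} → Rel (AR D) 0ℓ → Pred (AR D) 0ℓ → Rel Word 0ℓ
Covers _≈_ R π ρ =
  ∀ {x y} → x ∈ R → y ∈ R → Encodes (graph x) π → Encodes (graph y) ρ → Quotient.CoverGraph _≈_ x y

-- The induction hypothesis: R is a system of representatives of the classes, and Algorithm J tours
-- its words along covers.
record Generated {n} {D : Digraph n} (_≈_ : Rel (AR D) 0ℓ) (R : Pred (AR D) 0ℓ) : Set where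
  field
    representative : ∀ x → ∃ λ E → E ∈ R × x ≈ E
    unique         : ∀ {E F} → E ∈ R → F ∈ R → E ≈ F → E ≡ F
    initial        : idₙ n ∈ Π R
    tour           : Tour (Π R) (Covers _≈_ R) [ idₙ n ] (idₙ n)

Π-letters : ∀ {n} {D : Digraph n} {R : Pred (AR D) 0ℓ} {σ} → Π R σ → All (_< suc n) σ
Π-letters (_ , _ , e) = encodes-letters e

module _ {n} {D : Digraph n} {ls : Vec Link n} (p : Source (D ▹ ls) zero ⊎ Sink (D ▹ ls) zero)
         (simp : Simplicial (D ▹ ls) zero) (peo : PeoConsistent D)
         {_≈_ : Rel (AR (D ▹ ls)) 0ℓ} (C : IsLatticeCongruence _≈_)
         {R : Pred (AR (D ▹ ls)) 0ℓ} {R′ : Pred (AR D) 0ℓ}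
         (IH : Generated (Restriction p _≈_) R′)
         where

  open IsEquivalence (IsLatticeCongruence.isEquivalence C)
    renaming (refl to ≈-refl; sym to ≈-sym; trans to ≈-trans; reflexive to ≈-reflexive)
  open Generated IH renaming (representative to representative′; unique to unique′; initial to initial′; tour to tour′)

  private
    N = suc n
    o′ = pole p
    peo⁺ : PeoConsistent (D ▹ ls)
    peo⁺ = p , simp , peo

    L : Pred Word 0ℓ
    L = Π R
    L′ : Pred Word 0ℓ
    L′ = Π R′

    cover-graph-end : ∀ s {E F} → Quotient.CoverGraph (Restriction p _≈_) E F →
                      Quotient.CoverGraph _≈_ (rail-end p s E) (rail-end p s F)
    cover-graph-end s = Sum.map (cover-end p simp peo C s) (cover-end p simp peo C s)

    id-snoc : idₙ n ++ [ N ] ≡ idₙ N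
    id-snoc = applyUpTo-∷ʳ suc n

    encodes-rest : ∀ {x : AR (D ▹ ls)} {E} → rest x ≡ E → ∀ {σ} → Encodes (graph E) σ → Encodes (graph (rest x)) σ
    encodes-rest refl e = e

  -- The Boolean s selects `c` or `c̄`, whichever makes n a sink. Each rail lies in one class, so
  -- the class of x is determined by that of its restriction.
  generated-constant : ∀ s → (∀ E F G → F ∈ Rail E → G ∈ Rail E → F ≈ G) →
                       (∀ E v → link (rail-end p s E) v ≢ out) →
                       R ≐ (λ F → ∃ λ E → E ∈ R′ × F ≡ rail-end p s E) → Generated _≈_ R
  generated-constant s const ¬out (R⊆ , ⊆R) = record
    { representative = λ x → representative x (representative′ (rest x))
    ; unique         = unique
    ; initial        = subst L id-snoc (up initial′)
    ; tour           = subst (λ π → Tour L (Covers _≈_ R) [ π ] π) id-snoc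
        (tour-append (Π-letters {R = R′}) covers up L⇒ initial′
          (λ { _ (here refl) → here refl ; _ (there ()) })
          (λ { {σ} _ (here eq) → here (∷ʳ-injectiveˡ σ _ eq) ; _ (there ()) }) tour′)
    } where
    encodes-end : ∀ E {σ} → Encodes (graph E) σ → Encodes (graph (rail-end p s E)) (σ ++ [ N ])
    encodes-end E e = encodes-sink (rail-end p s E) (¬out E) (encodes-rest (rest-end p s E) e)
    up : ∀ {σ} → L′ σ → L (σ ++ [ N ])
    up (E , E∈ , e) = rail-end p s E , ⊆R (E , E∈ , refl) , encodes-end E e
    L⇒ : ∀ {ρ} → L ρ → ∃ λ σ → ρ ≡ σ ++ [ N ] × L′ σ
    L⇒ (x , x∈ , f) with E , E∈ , refl ← R⊆ x∈ with σ , e ← encodes-exists peo E =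
      σ , encodes-functional f (encodes-end E e) , E , E∈ , e
    base : ∀ {x σ} → x ∈ R → Encodes (graph x) (σ ++ [ N ]) →
           ∃ λ E → E ∈ R′ × x ≡ rail-end p s E × Encodes (graph E) σ
    base {σ = σ} x∈ f with E , E∈ , refl ← R⊆ x∈ with τ , e ← encodes-exists peo E =
      E , E∈ , refl , subst (Encodes (graph E)) (∷ʳ-injectiveˡ τ σ (encodes-functional (encodes-end E e) f)) e
    covers : ∀ {σ τ} → L′ σ → L′ τ → Covers (Restriction p _≈_) R′ σ τ →
             Covers _≈_ R (σ ++ [ N ]) (τ ++ [ N ])
    covers _ _ cov x∈ y∈ e f with E , E∈ , refl , e′ ← base x∈ e | F , F∈ , refl , f′ ← base y∈ f =
      cover-graph-end s (cov E∈ F∈ e′ f′)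
    representative : ∀ x → (∃ λ E → E ∈ R′ × c p (rest x) ≈ c p E) → ∃ λ F → F ∈ R × x ≈ F
    representative x (E , E∈ , eq) = rail-end p s E , ⊆R (E , E∈ , refl) ,
      ≈-trans (const (rest x) x (rail-end p s (rest x)) (rest-rail x)
                (trans (rest-rail (rail-end p s (rest x))) (cong graph (rest-end p s (rest x)))))
              (end-switch p simp peo C true s {rest x} {E} eq)
    unique : ∀ {x y} → x ∈ R → y ∈ R → x ≈ y → x ≡ y
    unique x∈ y∈ eq with E , E∈ , refl ← R⊆ x∈ | F , F∈ , refl ← R⊆ y∈ =
      cong (rail-end p s) (unique′ E∈ F∈ (end-switch p simp peo C s true {E} {F} eq))

  generated-injective : (∀ E → ¬ c p E ≈ c̄ p E) →
                        (choice : AR D → Pred (AR (D ▹ ls)) 0ℓ) →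
                        (∀ E → E ∈ R′ → IsRailChoice p _≈_ E (choice E)) →
                        R ≐ (λ F → ∃ λ E → E ∈ R′ × F ∈ choice E) → Generated _≈_ R
  generated-injective c≉c̄ choice isChoice (R⊆ , ⊆R) = record
    { representative = λ x → representative x (representative′ (rest x))
    ; unique         = unique
    ; initial        = subst L id-snoc (ends right initial′)
    ; tour           = subst (λ π → Tour L (Covers _≈_ R) [ π ] π) id-snoc
        (tour-zigzag (Π-letters {R = R′}) covers-ext L⇒ ends L? covers-rail left initial′ (here refl) (here refl)
          (λ { _ (here eq) σ≢ → contradiction eq σ≢ ; _ (there ()) })
          (λ { σ∈L′ i≤m (here eq) → here (ins-base (all<⇒∉ (Π-letters {R = R′} σ∈L′)) i≤m ≤-refl
                                           (trans eq (sym (ins-end (idₙ n)))))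
             ; _ _ (there ()) })
          (λ { _ (here eq) → eq ; _ (there ()) }) tour′)
    } where

    rest-choice : ∀ {E x} → E ∈ R′ → x ∈ choice E → rest x ≡ E
    rest-choice {E} {x} E∈ x∈ = rail⇒rest x (IsRailChoice.on-rail (isChoice E E∈) x∈)

    represent : ∀ {E} x → E ∈ R′ → rest x ≡ E →
                ∃ λ G → G ∈ choice E × G ≈ x × (∀ {H} → H ∈ choice E → H ≈ x → G ≡ H)
    represent {E} x E∈ eq
      with G , (G∈ , G≈x) , uniq ← IsRailChoice.exactly-one (isChoice E E∈) x (trans (rest-rail x) (cong graph eq))
      = G , G∈ , G≈x , λ H∈ H≈x → uniq (H∈ , H≈x)

    -- Without neighbours of n the two ends of a rail would coincide and hence be congruent.
    neighbour : ∃ λ v → lookup ls v ≢ none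
    neighbour with any? (λ v → lookup ls v ≟ˡ out) | any? (λ v → lookup ls v ≟ˡ inn)
    ... | yes (v , eq) | _ = v , λ eq′ → mark≢none true (trans (sym eq) eq′)
    ... | no _ | yes (v , eq) = v , λ eq′ → mark≢none false (trans (sym eq) eq′)
    ... | no ¬out | no ¬inn = contradiction
      (≈-reflexive (AR-ext-marked true {c p E} {c̄ p E} refl (λ v m → contradiction m (isolated (c p E)))
                                                            (λ v m → contradiction m (isolated (c̄ p E)))))
      (c≉c̄ E)
      where
      E = bot D peo true
      isolated : ∀ x {v} → link x v ≢ out
      isolated x {v} m =
        ¬inn (v , not-marked true (marked⇒≢none true x m) λ eq → ¬out (v , eq))

    -- `rail-end p o′` has n as a sink whether n is a source or a sink in D, so its word has N on
    -- the right.
    side : Direction → Bool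
    side right = o′
    side left  = not o′

    encodes-end : ∀ e E {σ} → Encodes (graph E) σ → Encodes (graph (rail-end p (side e) E)) (ext e N σ)
    encodes-end right E e′ = encodes-sink (rail-end p o′ E)
      (λ v m → end-unmarked p o′ E (trans m (sym (cong mark (signed-self o′)))))
      (encodes-rest (rest-end p o′ E) e′)
    encodes-end left E e′ = encodes-source (rail-end p (not o′) E)
      (λ v m → end-unmarked p (not o′) E (trans m (sym (cong mark (signed-not o′)))))
      (proj₂ neighbour) (encodes-rest (rest-end p (not o′) E) e′)

    end∈R : ∀ s {E} → E ∈ R′ → rail-end p s E ∈ R
    end∈R true  {E} E∈ = ⊆R (E , E∈ , IsRailChoice.contains-c (isChoice E E∈))
    end∈R false {E} E∈ = ⊆R (E , E∈ , IsRailChoice.contains-c̄ (isChoice E E∈))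

    ends : ∀ e {σ} → L′ σ → L (ext e N σ)
    ends e (E , E∈ , e′) = rail-end p (side e) E , end∈R (side e) E∈ , encodes-end e E e′

    base : ∀ {x i σ} → x ∈ R → i ≤ length σ → All (_< N) σ → Encodes (graph x) (ins N i σ) →
           Encodes (graph (rest x)) σ × rest x ∈ R′ × x ∈ choice (rest x)
    base {x} x∈ i≤m σ<N e with E , E∈ , x∈choice ← R⊆ x∈ with refl ← rest-choice E∈ x∈choice
      with xs , ys , eq , e′ , _ ← encodes-fits simp peo x e
      with refl , refl ← ins-split (all<⇒∉ σ<N) xs i≤m eq = e′ , E∈ , x∈choice

    L⇒ : ∀ {ρ} → L ρ → ∃₂ λ i σ → i ≤ length σ × ρ ≡ ins N i σ × L′ σ
    L⇒ (x , x∈ , e) with E , E∈ , x∈choice ← R⊆ x∈ with refl ← rest-choice E∈ x∈choice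
      with xs , ys , refl , e′ , _ ← encodes-fits simp peo x e =
      length xs , xs ++ ys , ≤-trans (m≤m+n _ _) (≤-reflexive (sym (length-++ xs))) ,
      sym (ins-++ xs) , rest x , E∈ , e′

    slot-only : ∀ x → rest x ∈ R′ → ∀ {σ i} → Encodes (graph (rest x)) σ → i ≤ length σ →
                (∀ y → rest y ≡ rest x → Encodes (graph y) (ins N i σ) → y ≡ x) →
                L (ins N i σ) → Encodes (graph x) (ins N i σ) × x ∈ choice (rest x)
    slot-only x E∈ e i≤m only (y , y∈ , h) with e′ , _ , y∈choice ← base y∈ i≤m (encodes-letters e) h
      with refl ← only y (encodes-injective peo (rest y) (rest x) e′ e) h = h , y∈choice

    -- Only one element x of the rail can occupy the slot. It remains to compare its word with the
    -- slot word and its chosen representative G with x; both are comparisons of words, for which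
    -- equality is decidable.
    L? : ∀ {σ i} → L′ σ → i ≤ length σ → Dec (L (ins N i σ))
    L? {σ} {i} (E , E∈ , e) i≤m with x , refl , only ← slot-element simp peo E i≤m e
      with ρ , f ← encodes-exists peo⁺ x
      with G , G∈ , G≈x , uniq ← represent x E∈ refl
      with τ , g ← encodes-exists peo⁺ G
      with ≡-dec _≟_ ρ (ins N i σ) | ≡-dec _≟_ τ ρ
    ... | yes refl | yes refl with refl ← encodes-injective peo⁺ G x g f = yes (x , ⊆R (rest x , E∈ , G∈) , f)
    ... | no ρ≢ | _ = no λ l → ρ≢ (encodes-functional f (proj₁ (only-x l)))
      where only-x = slot-only x E∈ e i≤m only
    ... | yes refl | no τ≢ρ = no λ l → τ≢ρ (encodes-functional g
                               (subst (λ y → Encodes (graph y) ρ) (sym (uniq (proj₂ (only-x l)) ≈-refl)) f))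
      where only-x = slot-only x E∈ e i≤m only

    representative : ∀ x → (∃ λ E → E ∈ R′ × c p (rest x) ≈ c p E) → ∃ λ F → F ∈ R × x ≈ F
    representative x (E , E∈ , eq) = found (transfer p simp peo C x E eq)
      where
      found : (∃ λ x′ → rest x′ ≡ E × x ≈ x′) → ∃ λ F → F ∈ R × x ≈ F
      found (x′ , rest-x′ , x≈x′) with G , G∈ , G≈x′ , _ ← represent x′ E∈ rest-x′ =
        G , ⊆R (E , E∈ , G∈) , ≈-trans x≈x′ (≈-sym G≈x′)

    unique-in-choice : ∀ {E F x y} → E ∈ R′ → F ∈ R′ → x ∈ choice E → y ∈ choice F → x ≈ y → E ≡ F → x ≡ y
    unique-in-choice {x = x} E∈ F∈ x∈ y∈ eq refl with _ , _ , _ , uniq ← represent x E∈ (rest-choice E∈ x∈) =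
      trans (sym (uniq x∈ ≈-refl)) (uniq y∈ (≈-sym eq))

    unique : ∀ {x y} → x ∈ R → y ∈ R → x ≈ y → x ≡ y
    unique {x} {y} x∈ y∈ eq = from-choice (R⊆ x∈) (R⊆ y∈)
      where
      rests : c p (rest x) ≈ c p (rest y)
      rests = end-rest-cong p simp peo C true eq
      from-choice : (∃ λ E → E ∈ R′ × x ∈ choice E) → (∃ λ F → F ∈ R′ × y ∈ choice F) → x ≡ y
      from-choice (E , E∈ , x∈choice) (F , F∈ , y∈choice) =
        unique-in-choice E∈ F∈ x∈choice y∈choice eq (unique′ E∈ F∈ restricted)
        where
        restricted : c p E ≈ c p F
        restricted = subst₂ (λ E F → c p E ≈ c p F) (rest-choice E∈ x∈choice) (rest-choice F∈ y∈choice) rests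

    covers-ext : ∀ e {σ τ} → L′ σ → L′ τ → Covers (Restriction p _≈_) R′ σ τ →
                 Covers _≈_ R (ext e N σ) (ext e N τ)
    covers-ext e (E , E∈ , e′) (F , F∈ , f′) cov {x} {y} x∈ y∈ f g
      with refl ← encodes-injective peo⁺ x (rail-end p (side e) E) f (encodes-end e E e′)
      with refl ← encodes-injective peo⁺ y (rail-end p (side e) F) g (encodes-end e F f′) =
      cover-graph-end (side e) (cov E∈ F∈ e′ f′)

    -- In the order `Le o′` the spreading mark is `out` in both cases, so that moving n to the left
    -- moves upwards.
    ordered : ∀ x y → rest x ≡ rest y → (∀ v → link y v ≡ out → link x v ≡ out) → Le o′ y x
    ordered x y eq to = Le-intro p o′ (subst (Le o′ (rest y)) (sym eq) (Le-refl o′))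
      λ v → subst (λ b → link y v ≡ mark b → link x v ≡ mark b) (sym (signed-self o′)) (to v)

    covers-rail : ∀ {σ i j} → L′ σ → i < j → j ≤ length σ → L (ins N i σ) → L (ins N j σ) →
                  (∀ {k} → i < k → k < j → ¬ L (ins N k σ)) →
                  Covers _≈_ R (ins N i σ) (ins N j σ) × Covers _≈_ R (ins N j σ) (ins N i σ)
    covers-rail {σ} {i} {j} σ∈L′ i<j j≤m _ _ gap =
      (λ x∈ y∈ f g → Sum.swap (covered x∈ y∈ f g)) , λ y∈ x∈ g f → covered x∈ y∈ f g
      where
      σ<N = Π-letters {R = R′} σ∈L′
      i≤m = ≤-trans (<⇒≤ i<j) j≤m
      position : ∀ x y → rest x ≡ rest y → ∀ {i j} → i ≤ j → j ≤ length σ → Encodes (graph (rest x)) σ →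
                 Encodes (graph x) (ins N i σ) → Encodes (graph y) (ins N j σ) → Le o′ y x
      position x y eq i≤j j≤m e f g = ordered x y eq (out-antitone simp peo x y eq i≤j j≤m e f g)
      covered : ∀ {x y} → x ∈ R → y ∈ R → Encodes (graph x) (ins N i σ) → Encodes (graph y) (ins N j σ) →
                Quotient.CoverGraph _≈_ y x
      covered {x} {y} x∈ y∈ f g
        with e , E∈ , _ ← base x∈ i≤m σ<N f | e′ , _ , _ ← base y∈ j≤m σ<N g
        = cover-Le peo⁺ C o′ (position x y same (<⇒≤ i<j) j≤m e f g) y≉x close
        where
        same : rest x ≡ rest y
        same = encodes-injective peo (rest x) (rest y) e e′
        y≉x : ¬ y ≈ x
        y≉x eq = <⇒≢ i<j (ins-injective (all<⇒∉ σ<N) i≤m j≤m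
          (encodes-functional f (subst (λ z → Encodes (graph z) (ins N j σ)) (unique y∈ x∈ eq) g)))
        close : ∀ w → Le o′ y w → Le o′ w x → w ≈ y ⊎ w ≈ x
        -- The ends of the interval have equal restrictions, so w lies on the same rail, and so does
        -- its representative G. By `gap`, G is encoded at or beyond one of the two words, and
        -- convexity puts w into the class of the element encoded there.
        close w y≤w w≤x
          with G , G∈ , G≈w , _ ← represent w E∈ (Le-antisym o′ (Le⇒rest p o′ w≤x)
                                     (subst (λ E → Le o′ E (rest w)) (sym same) (Le⇒rest p o′ y≤w)))
          with rest-G ← rest-choice E∈ G∈ | G∈R ← ⊆R (rest x , E∈ , G∈)
          with τ , g′ ← encodes-exists peo⁺ G
          with xs , ys , refl , e″ , _ ← encodes-fits simp peo G g′
          with refl ← encodes-functional e (subst (λ E → Encodes (graph E) (xs ++ ys)) rest-G e″)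
          with g″ ← subst (Encodes (graph G)) (sym (ins-++ xs)) g′
             | k≤m ← ≤-trans (m≤m+n (length xs) (length ys)) (≤-reflexive (sym (length-++ xs)))
          with ≤-<-connex (length xs) i | ≤-<-connex j (length xs)
        ... | inj₁ k≤i | _ = inj₂ (convex-Le peo⁺ C o′ w≤x (position G x rest-G k≤i i≤m e″ g″ f) (≈-sym G≈w))
        ... | inj₂ _ | inj₁ j≤k = inj₁ (≈-trans (≈-sym G≈w)
                (convex-Le peo⁺ C o′ (position y G (trans (sym same) (sym rest-G)) j≤k k≤m e′ g g″) y≤w G≈w))
        ... | inj₂ i<k | inj₂ k<j = contradiction (G , G∈R , g″) (gap i<k k<j)

generate : ∀ {n} {D : Digraph n} {peo : PeoConsistent D} {_≈_ : Rel (AR D) 0ℓ} {R : Pred (AR D) 0ℓ} →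
           IsLatticeCongruence _≈_ → IsR D peo _≈_ R → Generated _≈_ R
generate {D = ∅} {_≈_ = _≈_} {R} C (empty (R⊆ , ⊆R)) = record
  { representative = λ { x@(mkAR ∅ _ _) → x , ⊆R _ , IsEquivalence.refl (IsLatticeCongruence.isEquivalence C) }
  ; unique         = λ { {mkAR ∅ _ _} {mkAR ∅ _ _} _ _ _ → refl }
  ; initial        = mkAR ∅ ((λ _ _ → false) , λ ()) (λ ()) , ⊆R _ , empty
  ; tour           = halt (inj₁ λ { _ _ _ ((_ , J , _) , _) → no-jump J }) λ { (mkAR ∅ _ _ , _ , empty) → here refl }
  } where
  no-jump : ∀ {δ a d ρ} → ¬ Jump δ a d [] ρ
  no-jump J with () ← jump-∈ J
generate {peo = p , simp , peo} C (case₁ r c≉c̄ choice isChoice R≐) =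
  generated-injective p simp peo C (generate (restriction-congruence p simp peo C) r) c≉c̄ choice isChoice R≐
generate {D = D ▹ ls} {p , simp , peo} C (case₂-sink r const snk R≐) =
  generated-constant p simp peo C (generate (restriction-congruence p simp peo C) r) true const
    (λ E v → snk (suc v)) R≐
generate {D = D ▹ ls} {p , simp , peo} C (case₂-source r const src R≐) =
  generated-constant p simp peo C (generate (restriction-congruence p simp peo C) r) false const
    (λ E v m → src (suc v) (reversed v m)) R≐
  where
  reversed : ∀ v → lookup (Vec.map reverse ls) v ≡ out → lookup ls v ≡ inn
  reversed v m with lookup ls v | trans (sym (lookup-map v reverse ls)) m
  ... | inn | _ = refl

-- From tours to Hamilton paths

module _ {n} {D : Digraph n} (peo : PeoConsistent D) {_≈_ : Rel (AR D) 0ℓ} (C : IsLatticeCongruence _≈_)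
         {R : Pred (AR D) 0ℓ} (G : Generated _≈_ R) where

  open Generated G
  open IsEquivalence (IsLatticeCongruence.isEquivalence C) using () renaming (refl to ≈-refl)

  -- Freshness with respect to the growing list of visited words is what makes distinctness provable
  -- by induction on the tour.
  record Visits (visited : List Word) (π : Word) (x : AR D) : Set where
    field
      {words}    : List Word
      {elements} : List (AR D)
      run        : Run (Π R) visited π words
      encodes    : Pointwise (λ π E → Encodes (graph E) π) words elements
      members    : All (_∈ R) elements
      linked     : Linked (Quotient.CoverGraph _≈_) (x ∷ elements)
      fresh      : All (_∉ˡ visited) words
      distinct   : AllPairs _≢_ words
      complete   : ∀ {ρ} → Π R ρ → ρ ∈ˡ visited ⊎ ρ ∈ˡ words

  visits : ∀ {visited π x} → x ∈ R → Encodes (graph x) π →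
           Tour (Π R) (Covers _≈_ R) visited π → Visits visited π x
  visits x∈ e (halt stop all) = record
    { run = halt stop ; encodes = [] ; members = [] ; linked = [-]
    ; fresh = [] ; distinct = [] ; complete = inj₁ ∘ all }
  visits x∈ e (step {ρ} s@(_ , _ , _ , (_ , (y , y∈ , f) , ρ∉) , _) cov t) = record
    { run      = step s run
    ; encodes  = f ∷ encodes
    ; members  = y∈ ∷ members
    ; linked   = cov x∈ y∈ e f ∷ linked
    ; fresh    = ρ∉ ∷ All.map (λ σ∉ σ∈ → σ∉ (there σ∈)) fresh
    ; distinct = All.map (λ σ∉ ρ≡σ → σ∉ (here (sym ρ≡σ))) fresh ∷ distinct
    ; complete = λ σ∈ → [ (λ { (here eq) → inj₂ (here eq) ; (there σ∈) → inj₁ σ∈ }) , inj₂ ∘ there ]′ (complete σ∈)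
    }
    where open Visits (visits y∈ f t)

  -- R has one element per class, so congruent elements of R are equal and have equal words.
  inequivalent : ∀ {πs Es} → Pointwise (λ π E → Encodes (graph E) π) πs Es → All (_∈ R) Es →
                 AllPairs _≢_ πs → AllPairs (λ x y → ¬ x ≈ y) Es
  inequivalent []       []       []       = []
  inequivalent (e ∷ es) (r ∷ rs) (d ∷ ds) = head es rs d ∷ inequivalent es rs ds
    where
    head : ∀ {πs Es} → Pointwise (λ π E → Encodes (graph E) π) πs Es → All (_∈ R) Es →
           All (_ ≢_) πs → All (λ y → ¬ _ ≈ y) Es
    head []       []       []       = []
    head (f ∷ fs) (r′ ∷ rs) (d ∷ ds) =
      (λ eq → d (encodes-functional e (subst (λ E → Encodes (graph E) _) (sym (unique r r′ eq)) f))) ∷ head fs rs ds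

  covered : ∀ {πs Es E π} → Pointwise (λ π E → Encodes (graph E) π) πs Es →
            Encodes (graph E) π → π ∈ˡ πs → ∀ {x} → x ≈ E → Any (x ≈_) Es
  covered {E = E} (_∷_ {y = F} f fs) e (here refl) x≈E with refl ← encodes-injective peo E F e f = here x≈E
  covered (f ∷ fs) e (there π∈)  x≈E = there (covered fs e π∈ x≈E)

theorem35 : (n : ℕ) (D : Digraph n) (peo : PeoConsistent D)
    (_≈_ : Rel (AR D) 0ℓ) → IsLatticeCongruence _≈_ →
    (R : Pred (AR D) 0ℓ) → IsR D peo _≈_ R →
    ∃₂ λ (πs : List Word) (Es : List (AR D)) →
    AlgorithmJ n (Π R) (idₙ n) πs ×
    Pointwise (λ π E → Encodes (graph E) π) πs Es ×
    All (_∈ R) Es ×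
    IsHamiltonPath _≈_ Es
theorem35 n D peo _≈_ C R isR with G ← generate C isR
  with E₁ , E₁∈ , e₁ ← Generated.initial G
  with V ← visits peo C G E₁∈ e₁ (Generated.tour G) =
  idₙ n ∷ words , E₁ ∷ elements ,
  record { input = λ { (_ , _ , e) → encodes-permutation e } ; initial = E₁ , E₁∈ , e₁ ; visits = refl ; run = run } ,
  encodes′ , members′ ,
  record
    { consecutive = linked
    ; distinct    = inequivalent peo C G encodes′ members′
        (All.map (λ ρ∉ eq → ρ∉ (here (sym eq))) fresh ∷ distinct)
    ; covering    = λ x → covering x (Generated.representative G x)
    }
  where
  open Visits V
  encodes′ = e₁ ∷ encodes
  members′ = E₁∈ ∷ members
  covering : ∀ x → (∃ λ E → E ∈ R × x ≈ E) → Any (x ≈_) (E₁ ∷ elements)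
  covering x (E , E∈ , x≈E) with π , e ← encodes-exists peo E =
    covered peo C G encodes′ e ([ (λ { (here eq) → here eq }) , there ]′ (complete (E , E∈ , e))) x≈E
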